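{- For every integer $n>1$, $f(n)<n$.
   Context: For an integer $n>1$, consider the equation $$n=\left(X+\frac1x\right)\left(Y+\frac1y\right)$$ in positive integers $X,x,Y,y$ with $x>1$ and $y>1$. Two solutions obtained from each other by transposing the pairs $(X,x)$ and $(Y,y)$ are identified, and $f(n)$ denotes the number of solutions up to this identification. Since $x\neq y$ in every solution, $f(n)$ is equivalently the number of quadruples $(X,x,Y,y)$ of positive integers satisfying the equation with $1<x<y$. -}

module Defs where

open import Data.Fin.Base using (Fin)
open import Data.Integer.Base using (+_)
open import Data.Nat.Base using (ℕ; NonZero; _<_)
open import Data.Product.Base using (_×_; _,_; swap)
open import Data.Rational.Base using (ℚ; _/_; _+_; _*_)
open import Data.Sum.Base using (_⊎_; inj₁; inj₂)
open import Function.Bundles using (Inverse)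
open import Level using (0ℓ)
open import Relation.Binary.Bundles using (Setoid)
open import Relation.Binary.PropositionalEquality
  using (_≡_; refl; sym; trans; cong; setoid)

record Solution (n : ℕ) : Set where
  field
    X x Y y : ℕ
    {{X≢0}} : NonZero X
    {{x≢0}} : NonZero x
    {{Y≢0}} : NonZero Y
    {{y≢0}} : NonZero y
    1<x : 1 < x
    1<y : 1 < y
    equation : + n / 1 ≡ (+ X / 1 + + 1 / x) * (+ Y / 1 + + 1 / y)

  pairs : (ℕ × ℕ) × (ℕ × ℕ)
  pairs = (X , x) , (Y , y)

open Solution public using (pairs)

-- Equality of the underlying quadruples, up to transposing (X , x) and (Y , y).
_≈_ : ∀ {n} → Solution n → Solution n → Set
s ≈ t = pairs s ≡ pairs t ⊎ pairs s ≡ swap (pairs t)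

≈-refl : ∀ {n} {s : Solution n} → s ≈ s
≈-refl = inj₁ refl

≈-sym : ∀ {n} {s t : Solution n} → s ≈ t → t ≈ s
≈-sym (inj₁ p) = inj₁ (sym p)
≈-sym (inj₂ p) = inj₂ (sym (cong swap p))

≈-trans : ∀ {n} {s t u : Solution n} → s ≈ t → t ≈ u → s ≈ u
≈-trans (inj₁ p) (inj₁ q) = inj₁ (trans p q)
≈-trans (inj₁ p) (inj₂ q) = inj₂ (trans p q)
≈-trans (inj₂ p) (inj₁ q) = inj₂ (trans p (cong swap q))
≈-trans (inj₂ p) (inj₂ q) = inj₁ (trans p (cong swap q))

Solutions : ℕ → Setoid 0ℓ 0ℓ
Solutions n = record
  { Carrier       = Solution n
  ; _≈_           = _≈_
  ; isEquivalence = record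
    { refl  = λ {s} → ≈-refl {s = s}
    ; sym   = λ {s} {t} → ≈-sym {s = s} {t}
    ; trans = λ {s} {t} {u} → ≈-trans {s = s} {t} {u}
    }
  }

-- f(n) = k as a relation: finiteness of the solution set is not presupposed, so
-- the existence of some k with f[ n ]≡ k includes it.  Since the inverse is
-- between setoids, k counts classes of solutions modulo transposition.
f[_]≡_ : ℕ → ℕ → Set
f[ n ]≡ k = Inverse (setoid (Fin k)) (Solutions n)

{-# OPTIONS --safe #-}
module Submission where

-- y divides 1 + Xx and x divides 1 + Yy, so a solution is a factorisation n = ab
-- together with k = n − XY such that kx = a + Y, ky = b + X, ay = 1 + Xx and
-- bx = 1 + Yy; transposing lets us assume a ≤ b, and then a and min(X, Y) are at
-- most s = √n.  For fixed a, one more number determines the solution: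
--   Y if Y ≤ X, k ≤ Y (as n = XY + k),   k if Y ≤ X, Y < k (as a + Y = kx; k < a),
--   X if X < Y, k ≤ X,                   X if X < Y, y ≤ X < k (y inverts a mod X),
--   min(k, y) if X < k, y (as b + X = ky, so that min(k, y) ≤ 1 + √b).
-- This gives at most 5s solutions for each a, hence about (5/2) s d(n) in all, and
-- d(n)³ ≤ 1536n/35 makes this smaller than n from 480000 on.  Below that, a computed
-- bound on d(n) nearly always suffices; for the remaining n the list of candidates
-- is evaluated.

open import Data.Bool.Base using (Bool; true; false; _∧_)
open import Data.Empty using (⊥; ⊥-elim)
open import Data.Fin.Base as Fin using (Fin)
import Data.Fin.Properties as Fin
import Data.Integer.Base as ℤ
import Data.Integer.Properties as ℤ
open import Data.List.Base
  using (List; []; _∷_; _++_; length; lookup; map; filter; deduplicate; concatMap; applyDownFrom)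
open import Data.List.Membership.Propositional using (_∈_)
open import Data.List.Membership.Propositional.Properties
open import Data.List.Properties using (length-++; length-applyDownFrom; length-map; map-cong)
open import Data.List.Relation.Unary.All as All using (All)
open import Data.List.Relation.Unary.AllPairs as AllPairs using ()
open import Data.List.Relation.Unary.Any using (here; there; index)
import Data.List.Relation.Unary.Any.Properties as Any
open import Data.List.Relation.Unary.Unique.Propositional using (Unique)
import Data.List.Relation.Unary.Unique.Propositional.Properties as Unique
import Data.List.Relation.Unary.Unique.DecPropositional.Properties as DecUnique
open import Data.Nat.Base
  using (ℕ; zero; suc; _+_; _*_; _∸_; _^_; _/_; _%_; _≤_; _<_; _>_; z≤n; s≤s; z<s;
         NonZero; ≢-nonZero; >-nonZero; >-nonZero⁻¹)
open import Data.Nat.Coprimality using (Coprime; coprime-divisor)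
open import Data.Nat.Divisibility
open import Data.Nat.DivMod hiding (_/_; _%_)
open import Data.Nat.ListAction using (sum; product)
open import Data.Nat.Primality
open import Data.Nat.Primality.Factorisation using (factorise; PrimeFactorisation)
open import Data.Nat.Properties
open import Data.Nat.Tactic.RingSolver using (solve)
open import Data.Product.Base using (∃-syntax; _×_; _,_; proj₁; proj₂)
open import Data.Product.Properties using (≡-dec)
open import Data.Rational.Base as ℚ using (toℚᵘ)
import Data.Rational.Properties as ℚ
open import Data.Rational.Unnormalised.Base using (mkℚᵘ; *≡*; _≃_)
import Data.Rational.Unnormalised.Properties as ℚᵘ
open import Data.Sum.Base using (_⊎_; inj₁; inj₂; [_,_]′)
open import Function.Base using (_∘_; _$_)
open import Relation.Binary.Definitions using (DecidableEquality; tri<; tri≈; tri>)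
open import Relation.Binary.PropositionalEquality
  using (_≡_; _≢_; refl; sym; trans; cong; cong₂; subst; subst₂; module ≡-Reasoning)
open import Relation.Nullary using (Dec; yes; no; does; ¬_; contradiction)
open import Relation.Nullary.Decidable using (from-yes; _×-dec_; _⊎-dec_)

open import Defs

-- For fixed a, the numbers X and Y are individually bounded only by n. The given number must
-- therefore meet two demands: it is at most about √n, and it is large enough for the others to be
-- read off from remainders, which are unique only below the modulus. The comparisons of k, X, Y and
-- y arrange this. The resulting bound has order √n d(n), so d(n) must have smaller order than √n:
-- an estimate d² ≤ Cn would not do, and 3 is the next integral exponent. The best constant is the
-- product over p of the maxima of (i + 1)³ / pⁱ. These are 1 from p = 11 on because 8 < 11, hence
-- the special treatment of 2, 3, 5 and 7. As f is given by a bijection, an exact list of solutions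
-- is needed too. It comes from an exhaustive search unrelated to the candidates and is then mapped
-- injectively into them.

module ClearingDenominators where
  open import Data.Integer.Base using (+_)

  -- Unnormalised rationals involve no gcd, and with denominators written as successors the product
  -- computes, so the last step is `refl`.
  toℚᵘ-product : ∀ X x′ Y y′ →
    toℚᵘ ((+ X ℚ./ 1 ℚ.+ + 1 ℚ./ suc x′) ℚ.* (+ Y ℚ./ 1 ℚ.+ + 1 ℚ./ suc y′))
    ≃ mkℚᵘ (+ (suc (X * suc x′) * suc (Y * suc y′))) (y′ + x′ * suc y′)
  toℚᵘ-product X x′ Y y′ = ℚᵘ.≃-trans (ℚ.toℚᵘ-homo-* (+ X ℚ./ 1 ℚ.+ + 1 ℚ./ suc x′) (+ Y ℚ./ 1 ℚ.+ + 1 ℚ./ suc y′))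
    (ℚᵘ.≃-trans (ℚᵘ.*-cong (factor X x′) (factor Y y′)) (*≡* refl))
    where
    factor : ∀ Z z′ → toℚᵘ (+ Z ℚ./ 1 ℚ.+ + 1 ℚ./ suc z′) ≃ mkℚᵘ (+ suc (Z * suc z′)) z′
    factor Z z′ = ℚᵘ.≃-trans (ℚ.toℚᵘ-homo-+ (+ Z ℚ./ 1) (+ 1 ℚ./ suc z′)) (ℚᵘ.≃-trans
      (ℚᵘ.+-cong (ℚ.toℚᵘ-fromℚᵘ (mkℚᵘ (+ Z) 0)) (ℚ.toℚᵘ-fromℚᵘ (mkℚᵘ (+ 1) z′)))
      (*≡* (cong₂ ℤ._*_ num (cong +_ (sym (+-identityʳ (suc z′)))))))
      where
      num : + Z ℤ.* + suc z′ ℤ.+ + 1 ≡ + suc (Z * suc z′)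
      num = trans (cong (ℤ._+ + 1) (sym (ℤ.pos-* Z (suc z′)))) (cong +_ (+-comm (Z * suc z′) 1))

  equation⇒ℕ : ∀ n X x Y y .{{_ : NonZero x}} .{{_ : NonZero y}} →
    + n ℚ./ 1 ≡ (+ X ℚ./ 1 ℚ.+ + 1 ℚ./ x) ℚ.* (+ Y ℚ./ 1 ℚ.+ + 1 ℚ./ y) →
    n * (x * y) ≡ suc (X * x) * suc (Y * y)
  equation⇒ℕ n X x@(suc x′) Y y@(suc y′) eq
    with *≡* p ← ℚᵘ.≃-trans (ℚᵘ.≃-sym (ℚ.toℚᵘ-fromℚᵘ (mkℚᵘ (+ n) 0))) (ℚᵘ.≃-trans (ℚ.toℚᵘ-cong eq) (toℚᵘ-product X x′ Y y′))
    = ℤ.+-injective (trans (ℤ.pos-* n (x * y)) (trans p (ℤ.*-identityʳ _)))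

  ℕ⇒equation : ∀ n X x Y y .{{_ : NonZero x}} .{{_ : NonZero y}} →
    n * (x * y) ≡ suc (X * x) * suc (Y * y) →
    + n ℚ./ 1 ≡ (+ X ℚ./ 1 ℚ.+ + 1 ℚ./ x) ℚ.* (+ Y ℚ./ 1 ℚ.+ + 1 ℚ./ y)
  ℕ⇒equation n X x@(suc x′) Y y@(suc y′) eq = ℚ.toℚᵘ-injective (ℚᵘ.≃-trans (ℚ.toℚᵘ-fromℚᵘ (mkℚᵘ (+ n) 0)) (ℚᵘ.≃-trans
    (*≡* (trans (sym (ℤ.pos-* n (x * y))) (trans (cong +_ eq) (sym (ℤ.*-identityʳ _)))))
    (ℚᵘ.≃-sym (toℚᵘ-product X x′ Y y′))))

open ClearingDenominators using (equation⇒ℕ; ℕ⇒equation)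

-- The relations behind a solution

-- The fields are the relations that can be tested on a, b, k, X, Y alone, x and y being quotients
-- by k. The other two, ay = 1 + Xx and bx = 1 + Yy, follow from them.
record Pentagon (n a b k X Y x y : ℕ) : Set where
  field
    ab≡n   : a * b ≡ n
    XY+k≡n : X * Y + k ≡ n
    kx≡a+Y : k * x ≡ a + Y
    ky≡b+X : k * y ≡ b + X
    0<k    : 0 < k
    0<X    : 0 < X
    0<Y    : 0 < Y
    1<x    : 1 < x
    1<y    : 1 < y

module _ {n a b k X Y x y : ℕ} (p : Pentagon n a b k X Y x y) where
  open Pentagon p

  flip : Pentagon n b a k Y X y x
  flip = record
    { ab≡n = trans (*-comm b a) ab≡n ; XY+k≡n = trans (cong (_+ k) (*-comm Y X)) XY+k≡n
    ; kx≡a+Y = ky≡b+X ; ky≡b+X = kx≡a+Y ; 0<k = 0<k ; 0<X = 0<Y ; 0<Y = 0<X ; 1<x = 1<y ; 1<y = 1<x }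

  -- Multiplied by k, both sides become ab + aX = X(a + Y) + k.
  ay≡1+Xx : a * y ≡ suc (X * x)
  ay≡1+Xx = *-cancelˡ-≡ (a * y) (suc (X * x)) k {{>-nonZero 0<k}} (begin
    k * (a * y)       ≡⟨ solve (k ∷ a ∷ y ∷ []) ⟩
    a * (k * y)       ≡⟨ cong (a *_) ky≡b+X ⟩
    a * (b + X)       ≡⟨ *-distribˡ-+ a b X ⟩
    a * b + a * X     ≡⟨ cong (_+ a * X) (trans ab≡n (sym XY+k≡n)) ⟩
    X * Y + k + a * X ≡⟨ solve (k ∷ a ∷ X ∷ Y ∷ []) ⟩
    X * (a + Y) + k   ≡⟨ cong (λ z → X * z + k) kx≡a+Y ⟨
    X * (k * x) + k   ≡⟨ solve (k ∷ X ∷ x ∷ []) ⟩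
    k * suc (X * x)   ∎)
    where open ≡-Reasoning

bx≡1+Yy : ∀ {n a b k X Y x y} → Pentagon n a b k X Y x y → b * x ≡ suc (Y * y)
bx≡1+Yy = ay≡1+Xx ∘ flip

pentagon⇒solution : ∀ {n a b k X Y x y} → Pentagon n a b k X Y x y → n * (x * y) ≡ suc (X * x) * suc (Y * y)
pentagon⇒solution {n} {a} {b} {k} {X} {Y} {x} {y} p = begin
  n * (x * y)                   ≡⟨ cong (_* (x * y)) ab≡n ⟨
  a * b * (x * y)               ≡⟨ solve (a ∷ b ∷ x ∷ y ∷ []) ⟩
  (a * y) * (b * x)             ≡⟨ cong₂ _*_ (ay≡1+Xx p) (bx≡1+Yy p) ⟩
  suc (X * x) * suc (Y * y)     ∎
  where open Pentagon p; open ≡-Reasoning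

-- y divides nxy = (1 + Xx)(1 + Yy) and is coprime to 1 + Yy.
factor∣ : ∀ n X x Y y → n * (x * y) ≡ suc (X * x) * suc (Y * y) → y ∣ suc (X * x)
factor∣ n X x Y y eq = ∣m+n∣m⇒∣n
  (subst (y ∣_) (trans eq split) (∣n⇒∣m*n n (n∣m*n x)))
  (n∣m*n (suc (X * x) * Y))
  where
  split : suc (X * x) * suc (Y * y) ≡ suc (X * x) * Y * y + suc (X * x)
  split = solve (X ∷ x ∷ Y ∷ y ∷ [])

-- Subtracting XY·xy from the equation leaves kxy = 1 + Xx + Yy. The right side is ay + Yy and also
-- Xx + bx; cancelling y, respectively x, gives the relations for kx and ky.
solution⇒pentagon : ∀ n {X x Y y} .{{_ : NonZero x}} .{{_ : NonZero y}} → 0 < X → 1 < x → 0 < Y → 1 < y →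
  n * (x * y) ≡ suc (X * x) * suc (Y * y) → ∃[ a ] ∃[ b ] ∃[ k ] Pentagon n a b k X Y x y
solution⇒pentagon n {X} {x} {Y} {y} 0<X 1<x 0<Y 1<y eq
  = a , b , k , record
    { ab≡n = sym (*-cancelʳ-≡ n (a * b) (x * y) {{m*n≢0 x y}} (begin
        n * (x * y) ≡⟨ trans eq (cong₂ _*_ 1+Xx≡ay 1+Yy≡bx) ⟩
        a * y * (b * x) ≡⟨ swap₄ a y b x ⟩
        a * b * (x * y) ∎))
    ; XY+k≡n = XY+k≡n
    ; kx≡a+Y = *-cancelʳ-≡ (k * x) (a + Y) y (begin
        k * x * y               ≡⟨ kxy ⟩
        suc (X * x) + Y * y     ≡⟨ cong (_+ Y * y) 1+Xx≡ay ⟩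
        a * y + Y * y           ≡⟨ *-distribʳ-+ y a Y ⟨
        (a + Y) * y             ∎)
    ; ky≡b+X = *-cancelʳ-≡ (k * y) (b + X) x (begin
        k * y * x               ≡⟨ rot k y x ⟩
        k * x * y               ≡⟨ kxy ⟩
        suc (X * x) + Y * y     ≡⟨ +-suc (X * x) (Y * y) ⟨
        X * x + suc (Y * y)     ≡⟨ cong (λ z → X * x + z) 1+Yy≡bx ⟩
        X * x + b * x           ≡⟨ +-comm (X * x) (b * x) ⟩
        b * x + X * x           ≡⟨ *-distribʳ-+ x b X ⟨
        (b + X) * x             ∎)
    ; 0<k = n≢0⇒n>0 λ k≡0 → 0≢1+n (subst (λ z → z * x * y ≡ suc (X * x) + Y * y) k≡0 kxy)
    ; 0<X = 0<X ; 0<Y = 0<Y ; 1<x = 1<x ; 1<y = 1<y }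
  where
  open ≡-Reasoning
  y∣1+Xx : y ∣ suc (X * x)
  y∣1+Xx = factor∣ n X x Y y eq
  x∣1+Yy : x ∣ suc (Y * y)
  x∣1+Yy = factor∣ n Y y X x (trans (cong (n *_) (*-comm y x)) (trans eq (*-comm (suc (X * x)) _)))
  a b k : ℕ
  a = quotient y∣1+Xx
  b = quotient x∣1+Yy
  k = n ∸ X * Y
  1+Xx≡ay : suc (X * x) ≡ a * y
  1+Xx≡ay = _∣_.equality y∣1+Xx
  1+Yy≡bx : suc (Y * y) ≡ b * x
  1+Yy≡bx = _∣_.equality x∣1+Yy
  swap₄ : ∀ a y b x → a * y * (b * x) ≡ a * b * (x * y)
  swap₄ a y b x = solve (a ∷ y ∷ b ∷ x ∷ [])
  rot : ∀ k y x → k * y * x ≡ k * x * y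
  rot k y x = solve (k ∷ y ∷ x ∷ [])
  expand : ∀ X x Y y → suc (X * x) * suc (Y * y) ≡ X * Y * (x * y) + (suc (X * x) + Y * y)
  expand X x Y y = solve (X ∷ x ∷ Y ∷ y ∷ [])
  XY≤n : X * Y ≤ n
  XY≤n = *-cancelʳ-≤ (X * Y) n (x * y) {{m*n≢0 x y}} (≤-trans (m≤m+n _ _) (≤-reflexive (sym (trans eq (expand X x Y y)))))
  XY+k≡n : X * Y + k ≡ n
  XY+k≡n = m+[n∸m]≡n XY≤n
  kxy : k * x * y ≡ suc (X * x) + Y * y
  kxy = +-cancelˡ-≡ (X * Y * (x * y)) _ _ (begin
    X * Y * (x * y) + k * x * y ≡⟨ cong (λ z → X * Y * (x * y) + z) (*-assoc k x y) ⟩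
    X * Y * (x * y) + k * (x * y) ≡⟨ *-distribʳ-+ (x * y) (X * Y) k ⟨
    (X * Y + k) * (x * y)       ≡⟨ cong (_* (x * y)) XY+k≡n ⟩
    n * (x * y)                 ≡⟨ trans eq (expand X x Y y) ⟩
    X * Y * (x * y) + (suc (X * x) + Y * y) ∎)

-- Codes of solutions up to transposition

-- A code lists a , b , k , X , Y; then x = (a + Y) / k and y = (b + X) / k.
Code : Set
Code = ℕ × ℕ × ℕ × ℕ × ℕ

_≟ᶜ_ : DecidableEquality Code
_≟ᶜ_ = ≡-dec _≟_ (≡-dec _≟_ (≡-dec _≟_ (≡-dec _≟_ _≟_)))

-- Selects exactly one of two transposed solutions. In the tie a = b the numbers X and Y decide, and
-- they differ by `X≢Y`.
Normal : (a b X Y : ℕ) → Set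
Normal a b X Y = a < b ⊎ (a ≡ b × Y < X)

-- The bounds on 2k express x > 1 and y > 1 without forming the quotients.
Valid : ℕ → Code → Set
Valid n (a , b , k , X , Y) =
  k ∣ a + Y × k ∣ b + X × X * Y + k ≡ n × a * b ≡ n × 0 < k × 0 < X × 0 < Y ×
  2 * k ≤ a + Y × 2 * k ≤ b + X × Normal a b X Y

-- The divisibilities come first because they are the tests that fail most often.
valid? : ∀ n c → Dec (Valid n c)
valid? n (a , b , k , X , Y) =
  k ∣? a + Y ×-dec k ∣? b + X ×-dec X * Y + k ≟ n ×-dec a * b ≟ n ×-dec
  0 <? k ×-dec 0 <? X ×-dec 0 <? Y ×-dec 2 * k ≤? a + Y ×-dec 2 * k ≤? b + X ×-dec
  (a <? b ⊎-dec (a ≟ b ×-dec Y <? X))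

data Represents (n : ℕ) : Code → (ℕ × ℕ) × (ℕ × ℕ) → Set where
  represents : ∀ {a b k X Y x y} → Pentagon n a b k X Y x y → Normal a b X Y →
    Represents n (a , b , k , X , Y) ((X , x) , (Y , y))

represents⇒valid : ∀ {n c q} → Represents n c q → Valid n c
represents⇒valid {n} (represents {a} {b} {k} {X} {Y} {x} {y} p nf) =
  divides x (trans (sym kx≡a+Y) (*-comm k x)) , divides y (trans (sym ky≡b+X) (*-comm k y)) , XY+k≡n , ab≡n ,
  0<k , 0<X , 0<Y , twice x kx≡a+Y 1<x , twice y ky≡b+X 1<y , nf
  where
  open Pentagon p
  twice : ∀ z {m} → k * z ≡ m → 1 < z → 2 * k ≤ m
  twice z {m} kz≡m 1<z = subst (2 * k ≤_) (trans (*-comm z k) kz≡m) (*-monoˡ-≤ k 1<z)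

valid⇒represents : ∀ {n} c → Valid n c → ∃[ q ] Represents n c q
valid⇒represents {n} (a , b , k , X , Y) (divides x a+Y≡xk , divides y b+X≡yk , XY+k≡n , ab≡n , 0<k , 0<X , 0<Y , 2k≤a+Y , 2k≤b+X , nf) =
  _ , represents record
    { ab≡n = ab≡n ; XY+k≡n = XY+k≡n ; kx≡a+Y = trans (*-comm k x) (sym a+Y≡xk) ; ky≡b+X = trans (*-comm k y) (sym b+X≡yk)
    ; 0<k = 0<k ; 0<X = 0<X ; 0<Y = 0<Y ; 1<x = half x a+Y≡xk 2k≤a+Y ; 1<y = half y b+X≡yk 2k≤b+X } nf
  where
  half : ∀ z {m} → m ≡ z * k → 2 * k ≤ m → 1 < z
  half z m≡zk 2k≤m = *-cancelʳ-≤ 2 z k {{>-nonZero 0<k}} (≤-trans 2k≤m (≤-reflexive m≡zk))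

normal⇒≤ : ∀ {a b X Y} → Normal a b X Y → a ≤ b
normal⇒≤ (inj₁ a<b) = <⇒≤ a<b
normal⇒≤ (inj₂ (refl , _)) = ≤-refl

¬normal-flip : ∀ {a b X Y} → Normal a b X Y → ¬ Normal b a Y X
¬normal-flip (inj₁ a<b) (inj₁ b<a) = <-asym a<b b<a
¬normal-flip (inj₁ a<b) (inj₂ (b≡a , _)) = <-irrefl (sym b≡a) a<b
¬normal-flip (inj₂ (a≡b , _)) (inj₁ b<a) = <-irrefl (sym a≡b) b<a
¬normal-flip (inj₂ (_ , Y<X)) (inj₂ (_ , X<Y)) = <-asym Y<X X<Y

pentagon-unique : ∀ {n a b k a′ b′ k′ X Y x y} →
  Pentagon n a b k X Y x y → Pentagon n a′ b′ k′ X Y x y → a ≡ a′ × b ≡ b′ × k ≡ k′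
pentagon-unique {X = X} {Y} {x} {y} p p′ =
  *-cancelʳ-≡ _ _ y {{>-nonZero (<-trans z<s (Pentagon.1<y p))}} (trans (ay≡1+Xx p) (sym (ay≡1+Xx p′))) ,
  *-cancelʳ-≡ _ _ x {{>-nonZero (<-trans z<s (Pentagon.1<x p))}} (trans (bx≡1+Yy p) (sym (bx≡1+Yy p′))) ,
  +-cancelˡ-≡ (X * Y) _ _ (trans (Pentagon.XY+k≡n p) (sym (Pentagon.XY+k≡n p′)))

decode : ∀ {n c q} → Represents n c q → Solution n
decode {n} (represents {X = X} {Y} {x} {y} p _) = record
  { X = X ; x = x ; Y = Y ; y = y ; 1<x = 1<x ; 1<y = 1<y
  ; X≢0 = >-nonZero 0<X ; x≢0 = x≢0 ; Y≢0 = >-nonZero 0<Y ; y≢0 = y≢0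
  ; equation = ℕ⇒equation n X x Y y {{x≢0}} {{y≢0}} (pentagon⇒solution p)
  }
  where
  open Pentagon p
  x≢0 : NonZero x
  x≢0 = >-nonZero (<-trans z<s 1<x)
  y≢0 : NonZero y
  y≢0 = >-nonZero (<-trans z<s 1<y)

represents-unique : ∀ {n c c′ q q′} (r : Represents n c q) (r′ : Represents n c′ q′) → decode r ≈ decode r′ → c ≡ c′
represents-unique (represents p _) (represents p′ _) (inj₁ refl) with refl , refl , refl ← pentagon-unique p p′ = refl
represents-unique (represents p nf) (represents p′ nf′) (inj₂ refl) with refl , refl , refl ← pentagon-unique p (flip p′) =
  ⊥-elim (¬normal-flip nf nf′)

represents-injective : ∀ {n c q q′} (r : Represents n c q) (r′ : Represents n c q′) → decode r ≈ decode r′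
represents-injective (represents {k = k} {X} {Y} p _) (represents p′ _) = inj₁ (cong₂ (λ x y → (X , x) , (Y , y))
  (*-cancelˡ-≡ _ _ k {{>-nonZero (Pentagon.0<k p)}} (trans (Pentagon.kx≡a+Y p) (sym (Pentagon.kx≡a+Y p′))))
  (*-cancelˡ-≡ _ _ k {{>-nonZero (Pentagon.0<k p)}} (trans (Pentagon.ky≡b+X p) (sym (Pentagon.ky≡b+X p′)))))

-- X = Y and a = b would force x = y, but then x divides both Xx and 1 + Xx.
X≢Y : ∀ {n a k X x y} → ¬ Pentagon n a a k X X x y
X≢Y {a = a} {k} {X} {x} {y} p with refl ← *-cancelˡ-≡ x y k {{>-nonZero (Pentagon.0<k p)}} (trans (Pentagon.kx≡a+Y p) (sym (Pentagon.ky≡b+X p))) =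
  <-irrefl (sym (∣1⇒≡1 (∣m+n∣m⇒∣n (divides a (trans (+-comm (X * x) 1) (sym (ay≡1+Xx p)))) (n∣m*n X)))) (Pentagon.1<x p)

normalise : ∀ {n a b k X Y x y} → Pentagon n a b k X Y x y → Normal a b X Y ⊎ Normal b a Y X
normalise {a = a} {b} {X = X} {Y} p with <-cmp a b | <-cmp X Y
... | tri< a<b _ _  | _             = inj₁ (inj₁ a<b)
... | tri> _ _ b<a  | _             = inj₂ (inj₁ b<a)
... | tri≈ _ refl _ | tri< X<Y _ _  = inj₂ (inj₂ (refl , X<Y))
... | tri≈ _ refl _ | tri> _ _ Y<X  = inj₁ (inj₂ (refl , Y<X))
... | tri≈ _ refl _ | tri≈ _ refl _ = ⊥-elim (X≢Y p)

representation : ∀ {n} (s : Solution n) → let open Solution s in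
  ∃[ a ] ∃[ b ] ∃[ k ] Pentagon n a b k X Y x y → ∃[ c ] ∃[ q ] ∃[ r ] decode {n} {c} {q} r ≈ s
representation s (a , b , k , p) with normalise p
... | inj₁ nf = _ , _ , represents p nf , inj₁ refl
... | inj₂ nf = _ , _ , represents (flip p) nf , inj₂ refl

-- Abstract because unfolding it would normalise rational arithmetic.
abstract
  code : ∀ {n} (s : Solution n) → ∃[ c ] ∃[ q ] ∃[ r ] decode {n} {c} {q} r ≈ s
  code {n} s = representation s
    (solution⇒pentagon n (>-nonZero⁻¹ X) 1<x (>-nonZero⁻¹ Y) 1<y (equation⇒ℕ n X x Y y equation))
    where open Solution s

-- From a complete list of codes without repetition to the value of f

lookup-injective : ∀ {A : Set} {xs : List A} → Unique xs → ∀ i j → lookup xs i ≡ lookup xs j → i ≡ j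
lookup-injective (_    AllPairs.∷ _) Fin.zero    Fin.zero    _  = refl
lookup-injective (x∉xs AllPairs.∷ _) Fin.zero    (Fin.suc j) eq = ⊥-elim (All.lookup x∉xs (∈-lookup j) eq)
lookup-injective (x∉xs AllPairs.∷ _) (Fin.suc i) Fin.zero    eq = ⊥-elim (All.lookup x∉xs (∈-lookup i) (sym eq))
lookup-injective (_    AllPairs.∷ u) (Fin.suc i) (Fin.suc j) eq = cong Fin.suc (lookup-injective u i j eq)

module _ {n : ℕ} {cs : List Code} (unique : Unique cs)
  (sound : ∀ {c} → c ∈ cs → Valid n c) (complete : ∀ {c} → Valid n c → c ∈ cs) where

  private
    repr : ∀ i → ∃[ q ] Represents n (lookup cs i) q
    repr i = valid⇒represents (lookup cs i) (sound (∈-lookup i))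

    to : Fin (length cs) → Solution n
    to i = decode (proj₂ (repr i))

    from : Solution n → Fin (length cs)
    from s = let (c , q , r , _) = code s in index (complete (represents⇒valid r))

    from-spec : ∀ s → ∃[ q ] ∃[ r ] decode {n} {lookup cs (from s)} {q} r ≈ s
    from-spec s = let (c , q , r , r≈s) = code s in
      subst (λ c → ∃[ q ] ∃[ r ] decode {n} {c} {q} r ≈ s) (Any.lookup-index (complete (represents⇒valid r))) (q , r , r≈s)

    -- Equivalent solutions have equal codes, and each code is listed once. This gives both that
    -- `from` respects `_≈_` and that it is a left inverse of `to`.
    from-unique : ∀ s {i q} (r : Represents n (lookup cs i) q) → decode r ≈ s → from s ≡ i
    from-unique s {i} r r≈s = let (q , r′ , r′≈s) = from-spec s in
      lookup-injective unique _ _ (represents-unique r′ r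
        (≈-trans {s = decode r′} {s} {decode r} r′≈s (≈-sym {s = decode r} {s} r≈s)))

    from-cong : ∀ {s t} → s ≈ t → from s ≡ from t
    from-cong {s} {t} s≈t = let (q , r , r≈t) = from-spec t in
      from-unique s r (≈-trans {s = decode r} {t} {s} r≈t (≈-sym {s = s} {t} s≈t))

    to-from : ∀ s → to (from s) ≈ s
    to-from s = let (q , r , r≈s) = from-spec s in
      ≈-trans {s = to (from s)} {decode r} {s} (represents-injective (proj₂ (repr (from s))) r) r≈s

  solutions↔ : f[ n ]≡ length cs
  solutions↔ = record
    { to        = to
    ; from      = from
    ; to-cong   = λ { refl → inj₁ refl }
    ; from-cong = λ {s} {t} → from-cong {s} {t}
    ; inverse   = (λ { {s} refl → to-from s })
                , λ {i} {s} s≈i → from-unique s (proj₂ (repr i)) (≈-sym {s = s} {to i} s≈i)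
    }

-- Integer square root

sqrtRound : ℕ → ℕ → ℕ
sqrtRound n r with suc r * suc r ≤? n
... | yes _ = suc r
... | no  _ = r

-- The root of n is twice the root of n / 4, or one more, so logarithmically many steps suffice. The
-- first argument is fuel; n is enough, as n / 4 < n.
sqrtAux : ℕ → ℕ → ℕ
sqrtAux _       zero      = 0
sqrtAux zero    (suc _)   = 0
sqrtAux (suc f) n@(suc _) = sqrtRound n (2 * sqrtAux f (n / 4))

sqrt : ℕ → ℕ
sqrt n = sqrtAux n n

IsSqrt : ℕ → ℕ → Set
IsSqrt n s = s * s ≤ n × n < suc s * suc s

sqrtRound-isSqrt : ∀ n r → r * r ≤ n → n < (2 + r) * (2 + r) → IsSqrt n (sqrtRound n r)
sqrtRound-isSqrt n r r²≤n n<[2+r]² with suc r * suc r ≤? n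
... | yes [1+r]²≤n = [1+r]²≤n , n<[2+r]²
... | no  [1+r]²≰n = r²≤n , ≰⇒> [1+r]²≰n

sqrtRound-quarter : ∀ {n q p r} → n ≡ p + q * 4 → p < 4 → IsSqrt q r → IsSqrt n (sqrtRound n (2 * r))
sqrtRound-quarter {n} {q} {p} {r} n≡p+4q p<4 (r²≤q , q<[1+r]²) = sqrtRound-isSqrt n (2 * r)
  (begin
    2 * r * (2 * r) ≡⟨ double² r ⟩
    r * r * 4       ≤⟨ *-monoˡ-≤ 4 r²≤q ⟩
    q * 4           ≤⟨ m≤n+m (q * 4) p ⟩
    p + q * 4       ≡⟨ n≡p+4q ⟨
    n               ∎)
  (begin-strict
    n                           ≡⟨ n≡p+4q ⟩
    p + q * 4                   <⟨ +-monoˡ-< (q * 4) p<4 ⟩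
    suc q * 4                   ≤⟨ *-monoˡ-≤ 4 q<[1+r]² ⟩
    suc r * suc r * 4           ≡⟨ double² (suc r) ⟨
    2 * suc r * (2 * suc r)     ≡⟨ cong₂ _*_ (*-suc 2 r) (*-suc 2 r) ⟩
    (2 + 2 * r) * (2 + 2 * r)   ∎)
  where
  open ≤-Reasoning
  double² : ∀ m → 2 * m * (2 * m) ≡ m * m * 4
  double² m = trans ([m*n]*[o*p]≡[m*o]*[n*p] 2 m 2 m) (*-comm 4 (m * m))

sqrtAux-isSqrt : ∀ f n → n ≤ f → IsSqrt n (sqrtAux f n)
sqrtAux-isSqrt f       zero      _   = z≤n , z<s
sqrtAux-isSqrt (suc f) n@(suc _) n≤f = sqrtRound-quarter {r = sqrtAux f (n / 4)} (m≡m%n+[m/n]*n n 4) (m%n<n n 4)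
  (sqrtAux-isSqrt f (n / 4) (≤-pred (≤-trans (m/n<m n 4 (s≤s (s≤s z≤n))) n≤f)))

abstract
  sqrt-isSqrt : ∀ n → IsSqrt n (sqrt n)
  sqrt-isSqrt n = sqrtAux-isSqrt n n ≤-refl

sqrt-max : ∀ {n m} → m * m ≤ n → m ≤ sqrt n
sqrt-max {n} {m} m²≤n = ≮⇒≥ λ s<m → <⇒≱ (proj₂ (sqrt-isSqrt n)) (≤-trans (*-mono-≤ s<m s<m) m²≤n)

-- Division

-- Total division lets candidates be formed from arbitrary numbers without proofs that the divisor
-- is nonzero.
quot : ℕ → ℕ → ℕ
quot m zero      = 0
quot m n@(suc _) = m / n

quot-* : ∀ m {n} → 0 < n → quot (m * n) n ≡ m
quot-* m {suc n} _ = m*n/n≡m m (suc n)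

quot-monoˡ-≤ : ∀ {m n} d → m ≤ n → quot m d ≤ quot n d
quot-monoˡ-≤ zero    _   = z≤n
quot-monoˡ-≤ (suc d) m≤n = /-monoˡ-≤ (suc d) m≤n

remainder-unique : ∀ {m q r d} .{{_ : NonZero d}} → m ≡ r + q * d → r < d → m % d ≡ r
remainder-unique {q = q} {r} {d} refl r<d = trans ([m+kn]%n≡m%n r q d) (m<n⇒m%n≡m r<d)

quotient-unique : ∀ {m q r d} .{{_ : NonZero d}} → m ≡ r + q * d → r < d → m / d ≡ q
quotient-unique {m} {q} {r} {d} m≡r+qd r<d = *-cancelʳ-≡ (m / d) q d (+-cancelˡ-≡ r _ _ (begin
  r + m / d * d       ≡⟨ cong (_+ m / d * d) (remainder-unique {q = q} m≡r+qd r<d) ⟨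
  m % d + m / d * d   ≡⟨ m≡m%n+[m/n]*n m d ⟨
  m                   ≡⟨ m≡r+qd ⟩
  r + q * d           ∎))
  where open ≡-Reasoning

-- Since m ≡ -r modulo d, the remainder of m is d - r; r = d is included and corresponds to
-- remainder 0. This recovers Y from a modulo k, and X from b modulo k or modulo y.
complement-unique : ∀ {m d r} .{{_ : NonZero d}} q → d * q ≡ m + r → 0 < r → r ≤ d → d ∸ m % d ≡ r
complement-unique {m} {d} {r} zero dq≡m+r 0<r _ =
  ⊥-elim (<-irrefl (trans (sym (*-zeroʳ d)) dq≡m+r) (<-≤-trans 0<r (m≤n+m r m)))
complement-unique {m} {d} {r} (suc q) dq≡m+r 0<r r≤d =
  trans (cong (d ∸_) (remainder-unique {q = q} m≡ (∸-monoʳ-< 0<r r≤d))) (m∸[m∸n]≡n r≤d)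
  where
  open ≡-Reasoning
  m≡ : m ≡ d ∸ r + q * d
  m≡ = +-cancelʳ-≡ r _ _ (begin
    m + r                 ≡⟨ dq≡m+r ⟨
    d * suc q             ≡⟨ *-comm d (suc q) ⟩
    d + q * d             ≡⟨ cong (_+ q * d) (m∸n+n≡m r≤d) ⟨
    d ∸ r + r + q * d     ≡⟨ +-assoc (d ∸ r) r (q * d) ⟩
    d ∸ r + (r + q * d)   ≡⟨ cong (d ∸ r +_) (+-comm r (q * d)) ⟩
    d ∸ r + (q * d + r)   ≡⟨ +-assoc (d ∸ r) (q * d) r ⟨
    d ∸ r + q * d + r     ∎)

-- Both y and y′ invert a modulo X, so y ≡ y(ay′) = y′(ay) ≡ y′. As they lie between 1 and X, the
-- remainders compared are y - 1 and y′ - 1.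
inverse-unique : ∀ {a X x x′ y y′} → a * y ≡ suc (X * x) → a * y′ ≡ suc (X * x′) →
  0 < y → 0 < y′ → y ≤ X → y′ ≤ X → y ≡ y′
inverse-unique {a} {X} {x} {x′} {suc u} {suc u′} ay≡ ay′≡ _ _ u<X u′<X = cong suc (trans
  (sym (remainder-unique {q = suc u * x′} {{X≢0}} refl u<X))
  (remainder-unique {q = suc u′ * x} {{X≢0}} (suc-injective y[1+Xx′]≡y′[1+Xx]) u′<X))
  where
  X≢0 : NonZero X
  X≢0 = >-nonZero (≤-<-trans z≤n u<X)
  expand : ∀ y x → y + y * x * X ≡ y * suc (X * x)
  expand y x = trans (cong (y +_) (trans (*-assoc y x X) (cong (y *_) (*-comm x X)))) (sym (*-suc y (X * x)))
  swap₃ : ∀ y y′ → y * (a * y′) ≡ y′ * (a * y)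
  swap₃ y y′ = trans (*-comm y (a * y′)) (trans (cong (_* y) (*-comm a y′)) (*-assoc y′ a y))
  y[1+Xx′]≡y′[1+Xx] : suc u + suc u * x′ * X ≡ suc u′ + suc u′ * x * X
  y[1+Xx′]≡y′[1+Xx] = begin
    suc u + suc u * x′ * X        ≡⟨ expand (suc u) x′ ⟩
    suc u * suc (X * x′)          ≡⟨ cong (suc u *_) ay′≡ ⟨
    suc u * (a * suc u′)          ≡⟨ swap₃ (suc u) (suc u′) ⟩
    suc u′ * (a * suc u)          ≡⟨ cong (suc u′ *_) ay≡ ⟩
    suc u′ * suc (X * x)          ≡⟨ expand (suc u′) x ⟨
    suc u′ + suc u′ * x * X       ∎
    where open ≡-Reasoning

-- Lists

-- Pigeonhole on positions. Injectivity is asked only on entries of `xs`, because `merge` is shown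
-- injective only on codes of solutions.
length-≤ : ∀ {A B : Set} {xs : List A} {ys : List B} (f : A → B) → Unique xs →
  (∀ {x} → x ∈ xs → f x ∈ ys) → (∀ {x x′} → x ∈ xs → x′ ∈ xs → f x ≡ f x′ → x ≡ x′) →
  length xs ≤ length ys
length-≤ {xs = xs} {ys} f unique f∈ f-inj = Fin.injective⇒≤ {f = position} λ {i} {j} eq →
  lookup-injective unique i j (f-inj (∈-lookup i) (∈-lookup j) (begin
    f (lookup xs i)                 ≡⟨ Any.lookup-index (f∈ (∈-lookup i)) ⟩
    lookup ys (position i)          ≡⟨ cong (lookup ys) eq ⟩
    lookup ys (position j)          ≡⟨ Any.lookup-index (f∈ (∈-lookup j)) ⟨
    f (lookup xs j)                 ∎))
  where
  open ≡-Reasoning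
  position : Fin (length xs) → Fin (length ys)
  position i = index (f∈ (∈-lookup i))

length-concatMap : ∀ {A B : Set} (f : A → List B) xs → length (concatMap f xs) ≡ sum (map (length ∘ f) xs)
length-concatMap f []       = refl
length-concatMap f (x ∷ xs) = trans (length-++ (f x)) (cong (length (f x) +_) (length-concatMap f xs))

sum-map-≤ : ∀ {A : Set} (f : A → ℕ) {m} xs → (∀ {x} → x ∈ xs → f x ≤ m) → sum (map f xs) ≤ length xs * m
sum-map-≤ f []       _   = z≤n
sum-map-≤ f (x ∷ xs) f≤m = +-mono-≤ (f≤m (here refl)) (sum-map-≤ f xs (f≤m ∘ there))

∈-concatMap : ∀ {A B : Set} (f : A → List B) {x y xs} → x ∈ xs → y ∈ f x → y ∈ concatMap f xs
∈-concatMap f x∈xs y∈fx = ∈-concat⁺′ y∈fx (∈-map⁺ f x∈xs)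

∈-applyDownFrom-suc : ∀ {m n} → 0 < m → m ≤ n → m ∈ applyDownFrom suc n
∈-applyDownFrom-suc {suc m} _ m<n = ∈-applyDownFrom⁺ suc m<n

divisorsUpTo : ℕ → ℕ → List ℕ
divisorsUpTo n s = filter (_∣? n) (applyDownFrom suc s)

∈-divisorsUpTo⁺ : ∀ {n s a} → 0 < a → a ≤ s → a ∣ n → a ∈ divisorsUpTo n s
∈-divisorsUpTo⁺ {n} 0<a a≤s = ∈-filter⁺ (_∣? n) (∈-applyDownFrom-suc 0<a a≤s)

∈-divisorsUpTo⁻ : ∀ {n s a} → a ∈ divisorsUpTo n s → 0 < a × a ≤ s × a ∣ n
∈-divisorsUpTo⁻ {n} {s} a∈ with ∈-filter⁻ (_∣? n) {xs = applyDownFrom suc s} a∈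
... | a∈′ , a∣n with ∈-applyDownFrom⁻ suc a∈′
... | _ , i<s , refl = z<s , i<s , a∣n

-- The list of all solutions

-- A crude search space, indexed by a, X and Y, which determine b and k. Its own length is never
-- estimated.
box : ℕ → List Code
box n = concatMap (λ a → concatMap (λ X →
  applyDownFrom (λ j → a , quot n a , n ∸ X * suc j , X , suc j) (quot n X)) (applyDownFrom suc n)) (divisorsUpTo n (sqrt n))

solutionCodes : ℕ → List Code
solutionCodes n = deduplicate _≟ᶜ_ (filter (valid? n) (box n))

∈-box : ∀ {n c q} → Represents n c q → c ∈ box n
∈-box {n} (represents {a} {b} {k} {X} {suc Y} p nf) =
  ∈-concatMap _ (∈-divisorsUpTo⁺ 0<a (sqrt-max (≤-trans (*-monoʳ-≤ a (normal⇒≤ nf)) (≤-reflexive ab≡n)))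
    (divides b (trans (sym ab≡n) (*-comm a b))))
  (∈-concatMap _ (∈-applyDownFrom-suc 0<X (≤-trans (m≤m*n X (suc Y)) XY≤n))
  (subst (_∈ applyDownFrom row (quot n X)) code≡ (∈-applyDownFrom⁺ row Y<n/X)))
  where
  open Pentagon p
  row : ℕ → Code
  row j = a , quot n a , n ∸ X * suc j , X , suc j
  0<ab : 0 < a * b
  0<ab = subst (0 <_) (sym ab≡n) (<-≤-trans 0<k (≤-trans (m≤n+m k (X * suc Y)) (≤-reflexive XY+k≡n)))
  0<a : 0 < a
  0<a = n≢0⇒n>0 λ { refl → <-irrefl refl 0<ab }
  XY≤n : X * suc Y ≤ n
  XY≤n = ≤-trans (m≤m+n _ k) (≤-reflexive XY+k≡n)
  Y<n/X : Y < quot n X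
  Y<n/X = subst (_≤ quot n X) (quot-* (suc Y) 0<X) (quot-monoˡ-≤ X (≤-trans (≤-reflexive (*-comm (suc Y) X)) XY≤n))
  code≡ : (a , quot n a , n ∸ X * suc Y , X , suc Y) ≡ (a , b , k , X , suc Y)
  code≡ = cong₂ (λ b k → a , b , k , X , suc Y)
    (trans (cong (λ m → quot m a) (trans (sym ab≡n) (*-comm a b))) (quot-* b 0<a))
    (trans (cong (_∸ X * suc Y) (sym XY+k≡n)) (m+n∸m≡n (X * suc Y) k))

-- Candidates

-- The argument j below is one less than the given number.  Given numbers that belong
-- to no solution yield meaningless codes, which only weakens the bound.
withX withY : (n a b k : ℕ) → ℕ → Code
withX n a b k X = a , b , k , X , quot (n ∸ k) X
withY n a b k Y = a , b , k , quot (n ∸ k) Y , Y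

withy : (n a b y : ℕ) → ℕ → Code
withy n a b y X = withX n a b (quot (b + X) y) X

module _ (n a b : ℕ) where

  givenX givenY givenk>X givenk>Y giveny>X givenX≥y : ℕ → Code
  -- For k ≤ Y, n - 1 = XY + (k - 1) is a division with remainder k - 1 < Y; dividing n itself would
  -- miss k = Y.
  givenY   j = a , b , suc ((n ∸ 1) % suc j) , (n ∸ 1) / suc j , suc j
  givenX   j = a , b , suc ((n ∸ 1) % suc j) , suc j , (n ∸ 1) / suc j
  givenk>Y j = withY n a b (suc j) (suc j ∸ a % suc j)
  givenk>X j = withX n a b (suc j) (suc j ∸ b % suc j)
  giveny>X j = withy n a b (suc j) (suc j ∸ b % suc j)
  givenX≥y j = a , b , 0 , suc j , 0

  block : ℕ → List Code
  block s = applyDownFrom givenY s ++ applyDownFrom givenX s ++ applyDownFrom givenk>Y (a ∸ 1) ++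
    -- Here X ≥ 1 lies below the given k or y, so the value 1 is skipped and the given number runs
    -- from 2 to t + 1.
    applyDownFrom (givenk>X ∘ suc) t ++ applyDownFrom (giveny>X ∘ suc) t ++ applyDownFrom givenX≥y s
    where
    t : ℕ
    t = sqrt (b ∸ 1)

candidatesUpTo : ℕ → ℕ → List Code
candidatesUpTo n s = concatMap (λ a → block n a (quot n a) s) (divisorsUpTo n s)

candidates : ℕ → List Code
candidates n = candidatesUpTo n (sqrt n)

-- If X < Y, X < k and y ≤ X (that is, b + X ≤ kX), then X determines the solution.  Its
-- candidate has the impossible values k = Y = 0, which saves inverting a modulo X.
Merged : Code → Set
Merged (a , b , k , X , Y) = X < Y × X < k × b + X ≤ k * X

merged? : ∀ c → Dec (Merged c)
merged? (a , b , k , X , Y) = X <? Y ×-dec X <? k ×-dec b + X ≤? k * X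

merge : Code → Code
merge c@(a , b , k , X , Y) with merged? c
... | yes _ = a , b , 0 , X , 0
... | no  _ = c

y≤X : ∀ {n a b k X Y x y} → Pentagon n a b k X Y x y → b + X ≤ k * X → y ≤ X
y≤X {k = k} p h = *-cancelˡ-≤ k {{>-nonZero (Pentagon.0<k p)}} (≤-trans (≤-reflexive (Pentagon.ky≡b+X p)) h)

merged-unique : ∀ {n a b k k′ X Y Y′ x x′ y y′} → Pentagon n a b k X Y x y → Pentagon n a b k′ X Y′ x′ y′ →
  b + X ≤ k * X → b + X ≤ k′ * X → k ≡ k′ × Y ≡ Y′
merged-unique {n} {a} {b} {k} {k′} {X} {Y} {Y′} {x} {x′} {y} {y′} p p′ h h′
  with refl ← inverse-unique {a} {X} {x} {x′} {y} {y′} (ay≡1+Xx p) (ay≡1+Xx p′)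
    (<-trans z<s (Pentagon.1<y p)) (<-trans z<s (Pentagon.1<y p′)) (y≤X p h) (y≤X p′ h′)
  with refl ← *-cancelʳ-≡ k k′ y {{>-nonZero (<-trans z<s (Pentagon.1<y p))}} (trans (Pentagon.ky≡b+X p) (sym (Pentagon.ky≡b+X p′)))
  = refl , *-cancelˡ-≡ Y Y′ X {{>-nonZero (Pentagon.0<X p)}} (+-cancelʳ-≡ k _ _ (trans (Pentagon.XY+k≡n p) (sym (Pentagon.XY+k≡n p′))))

-- A merged code keeps a, b and X, which suffice by `merged-unique`. It cannot collide with an
-- unmerged code, where k > 0.
merge-injective : ∀ {n c c′ q q′} → Represents n c q → Represents n c′ q′ → merge c ≡ merge c′ → c ≡ c′
merge-injective {c = c} {c′} (represents p _) (represents p′ _) eq with merged? c | merged? c′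
merge-injective (represents p _) (represents p′ _) refl | yes (_ , _ , h) | yes (_ , _ , h′)
  with refl , refl ← merged-unique p p′ h h′ = refl
merge-injective (represents p _) (represents p′ _) refl | yes _ | no _ = ⊥-elim (<-irrefl refl (Pentagon.0<k p′))
merge-injective (represents p _) (represents p′ _) refl | no _ | yes _ = ⊥-elim (<-irrefl refl (Pentagon.0<k p))
... | no _ | no _ = eq

-- Recovering a solution from one given number

module _ {n a b k X Y x y : ℕ} (p : Pentagon n a b k X Y x y) where
  open Pentagon p

  n∸k≡XY : n ∸ k ≡ X * Y
  n∸k≡XY = trans (cong (_∸ k) (sym XY+k≡n)) (m+n∸n≡m (X * Y) k)

  withX≡ : withX n a b k X ≡ (a , b , k , X , Y)
  withX≡ = cong (λ Y → a , b , k , X , Y) (trans (cong (λ m → quot m X) (trans n∸k≡XY (*-comm X Y))) (quot-* Y 0<X))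

  withY≡ : withY n a b k Y ≡ (a , b , k , X , Y)
  withY≡ = cong (λ X → a , b , k , X , Y) (trans (cong (λ m → quot m Y) n∸k≡XY) (quot-* X 0<Y))

  withy≡ : withy n a b y X ≡ (a , b , k , X , Y)
  withy≡ = trans
    (cong (λ k → withX n a b k X) (trans (cong (λ m → quot m y) (sym ky≡b+X)) (quot-* k (<-trans z<s 1<y)))) withX≡

  a>0 : 0 < a
  a>0 = n≢0⇒n>0 λ { refl → <-irrefl (sym (m+n≡0⇒n≡0 (X * Y) (trans XY+k≡n (sym ab≡n)))) 0<k }

  XY<n : X * Y < n
  XY<n = ≤-trans (m<m+n (X * Y) 0<k) (≤-reflexive XY+k≡n)

givenY≡ : ∀ {n a b k X j x y} → Pentagon n a b k X (suc j) x y → k ≤ suc j → givenY n a b j ≡ (a , b , k , X , suc j)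
givenY≡ {n} {a} {b} {zero} p _ = ⊥-elim (<-irrefl refl (Pentagon.0<k p))
givenY≡ {n} {a} {b} {suc k} {X} {j} p k<1+j = cong₂ (λ k X → a , b , suc k , X , suc j)
  (remainder-unique {q = X} n∸1≡ k<1+j) (quotient-unique {q = X} n∸1≡ k<1+j)
  where
  n∸1≡ : n ∸ 1 ≡ k + X * suc j
  n∸1≡ = cong (_∸ 1) (trans (sym (Pentagon.XY+k≡n p)) (+-comm (X * suc j) (suc k)))

swapCode : Code → Code
swapCode (a , b , k , X , Y) = b , a , k , Y , X

givenX≡ : ∀ {n a b k j Y x y} → Pentagon n a b k (suc j) Y x y → k ≤ suc j → givenX n a b j ≡ (a , b , k , suc j , Y)
givenX≡ p k≤1+j = cong swapCode (givenY≡ (flip p) k≤1+j)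

givenk>Y≡ : ∀ {n a b j X Y x y} → Pentagon n a b (suc j) X Y x y → Y ≤ suc j → givenk>Y n a b j ≡ (a , b , suc j , X , Y)
givenk>Y≡ {n} {a} {b} {j} {x = x} p Y≤k =
  trans (cong (withY n a b (suc j)) (complement-unique x (Pentagon.kx≡a+Y p) (Pentagon.0<Y p) Y≤k)) (withY≡ p)

givenk>X≡ : ∀ {n a b j X Y x y} → Pentagon n a b (suc j) X Y x y → X ≤ suc j → givenk>X n a b j ≡ (a , b , suc j , X , Y)
givenk>X≡ {n} {a} {b} {j} {y = y} p X≤k =
  trans (cong (withX n a b (suc j)) (complement-unique y (Pentagon.ky≡b+X p) (Pentagon.0<X p) X≤k)) (withX≡ p)

giveny>X≡ : ∀ {n a b k j X Y x} → Pentagon n a b k X Y x (suc j) → X ≤ suc j → giveny>X n a b j ≡ (a , b , k , X , Y)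
giveny>X≡ {n} {a} {b} {k} {j} p X≤y =
  trans (cong (withy n a b (suc j)) (complement-unique k (trans (*-comm (suc j) k) (Pentagon.ky≡b+X p)) (Pentagon.0<X p) X≤y)) (withy≡ p)

-- Here j + 1 is the smaller of k and y, and v the other. From jv + (j + 1) ≤ (j + 1)v = b + X ≤ b +
-- j follows jv < b, hence j² ≤ b - 1.
≤-sqrt-pred : ∀ {b X j v} → suc j * v ≡ b + X → X < suc j → suc j ≤ v → j ≤ sqrt (b ∸ 1)
≤-sqrt-pred {b} {X} {j} {v} eq X≤j j<v = sqrt-max (≤-trans (*-monoʳ-≤ j (<⇒≤ j<v)) (<⇒≤pred (+-cancelʳ-≤ j _ _ (begin
  suc (j * v) + j   ≡⟨ +-suc (j * v) j ⟨
  j * v + suc j     ≤⟨ +-monoʳ-≤ (j * v) j<v ⟩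
  j * v + v         ≡⟨ +-comm (j * v) v ⟩
  suc j * v         ≡⟨ eq ⟩
  b + X             ≤⟨ +-monoʳ-≤ b (≤-pred X≤j) ⟩
  b + j             ∎))))
  where open ≤-Reasoning

module _ {n a b s : ℕ} {c : Code} where
  private
    t : ℕ
    t = sqrt (b ∸ 1)

  ∈-givenY : c ∈ applyDownFrom (givenY n a b) s → c ∈ block n a b s
  ∈-givenY = ∈-++⁺ˡ

  ∈-givenX : c ∈ applyDownFrom (givenX n a b) s → c ∈ block n a b s
  ∈-givenX = ∈-++⁺ʳ (applyDownFrom (givenY n a b) s) ∘ ∈-++⁺ˡ

  ∈-rest₂ : c ∈ applyDownFrom (givenk>Y n a b) (a ∸ 1) ++ applyDownFrom (givenk>X n a b ∘ suc) t ++
    applyDownFrom (giveny>X n a b ∘ suc) t ++ applyDownFrom (givenX≥y n a b) s → c ∈ block n a b s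
  ∈-rest₂ = ∈-++⁺ʳ (applyDownFrom (givenY n a b) s) ∘ ∈-++⁺ʳ (applyDownFrom (givenX n a b) s)

  ∈-givenk>Y : c ∈ applyDownFrom (givenk>Y n a b) (a ∸ 1) → c ∈ block n a b s
  ∈-givenk>Y = ∈-rest₂ ∘ ∈-++⁺ˡ

  ∈-givenk>X : c ∈ applyDownFrom (givenk>X n a b ∘ suc) t → c ∈ block n a b s
  ∈-givenk>X = ∈-rest₂ ∘ ∈-++⁺ʳ (applyDownFrom (givenk>Y n a b) (a ∸ 1)) ∘ ∈-++⁺ˡ

  ∈-giveny>X : c ∈ applyDownFrom (giveny>X n a b ∘ suc) t → c ∈ block n a b s
  ∈-giveny>X = ∈-rest₂ ∘ ∈-++⁺ʳ (applyDownFrom (givenk>Y n a b) (a ∸ 1)) ∘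
    ∈-++⁺ʳ (applyDownFrom (givenk>X n a b ∘ suc) t) ∘ ∈-++⁺ˡ

  ∈-givenX≥y : c ∈ applyDownFrom (givenX≥y n a b) s → c ∈ block n a b s
  ∈-givenX≥y = ∈-rest₂ ∘ ∈-++⁺ʳ (applyDownFrom (givenk>Y n a b) (a ∸ 1)) ∘
    ∈-++⁺ʳ (applyDownFrom (givenk>X n a b ∘ suc) t) ∘ ∈-++⁺ʳ (applyDownFrom (giveny>X n a b ∘ suc) t)

∈-applyDownFrom : ∀ (f : ℕ → Code) {c i n} → i < n → f i ≡ c → c ∈ applyDownFrom f n
∈-applyDownFrom f i<n refl = ∈-applyDownFrom⁺ f i<n

module _ {n : ℕ} where
  private
    s : ℕ
    s = sqrt n

  ∈-block-Y≤X : ∀ {a b k X Y x y} → Pentagon n a b k X Y x y → Y ≤ X → (a , b , k , X , Y) ∈ block n a b s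
  ∈-block-Y≤X {a} {b} {k} {X} {Y} {x} p Y≤X with k ≤? Y
  ... | yes k≤Y = ∈-givenY {n} {a} {b} {s} (go p (sqrt-max (≤-trans (*-monoˡ-≤ Y Y≤X) (<⇒≤ (XY<n p)))) k≤Y)
    where
    go : ∀ {Y x y} → Pentagon n a b k X Y x y → Y ≤ s → k ≤ Y → (a , b , k , X , Y) ∈ applyDownFrom (givenY n a b) s
    go {zero}  p _   _   = ⊥-elim (<-irrefl refl (Pentagon.0<Y p))
    go {suc j} p j<s k≤Y = ∈-applyDownFrom (givenY n a b) j<s (givenY≡ p k≤Y)
  ... | no k≰Y = ∈-givenk>Y {n} {a} {b} {s} (go p (≰⇒> k≰Y) k<a)
    where
    -- As x ≥ 2, 2k ≤ kx = a + Y < a + k.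
    k<a : k < a
    k<a = +-cancelʳ-≤ k _ _ (begin
      suc k + k     ≡⟨ cong suc (cong (k +_) (sym (+-identityʳ k))) ⟩
      suc (2 * k)   ≤⟨ s≤s (≤-trans (*-monoˡ-≤ k (Pentagon.1<x p)) (≤-reflexive (trans (*-comm x k) (Pentagon.kx≡a+Y p)))) ⟩
      suc (a + Y)   ≡⟨ +-suc a Y ⟨
      a + suc Y     ≤⟨ +-monoʳ-≤ a (≰⇒> k≰Y) ⟩
      a + k         ∎)
      where open ≤-Reasoning
    go : ∀ {k x y} → Pentagon n a b k X Y x y → Y < k → k < a → (a , b , k , X , Y) ∈ applyDownFrom (givenk>Y n a b) (a ∸ 1)
    go {suc j} p Y<k k<a = ∈-applyDownFrom (givenk>Y n a b) (<⇒≤pred k<a) (givenk>Y≡ p (<⇒≤ Y<k))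

  ∈-block-X<Y : ∀ {a b k X Y x y} → Pentagon n a b k X Y x y → ¬ Merged (a , b , k , X , Y) → X < Y →
    (a , b , k , X , Y) ∈ block n a b s
  ∈-block-X<Y {a} {b} {k} {X} {Y} {x} {y} p ¬merged X<Y with k ≤? X
  ... | yes k≤X = ∈-givenX {n} {a} {b} {s} (go p (sqrt-max (≤-trans (*-monoʳ-≤ X (<⇒≤ X<Y)) (<⇒≤ (XY<n p)))) k≤X)
    where
    go : ∀ {X x y} → Pentagon n a b k X Y x y → X ≤ s → k ≤ X → (a , b , k , X , Y) ∈ applyDownFrom (givenX n a b) s
    go {zero}  p _   _   = ⊥-elim (<-irrefl refl (Pentagon.0<X p))
    go {suc j} p j<s k≤X = ∈-applyDownFrom (givenX n a b) j<s (givenX≡ p k≤X)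
  ... | no k≰X with ≤-total k y
  ...   | inj₁ k≤y = ∈-givenk>X {n} {a} {b} {s} (go p (≰⇒> k≰X) k≤y)
    where
    go : ∀ {k x y} → Pentagon n a b k X Y x y → X < k → k ≤ y →
      (a , b , k , X , Y) ∈ applyDownFrom (givenk>X n a b ∘ suc) (sqrt (b ∸ 1))
    go {1}           p X<k _   = ⊥-elim (<⇒≱ X<k (Pentagon.0<X p))
    go {suc (suc j)} p X<k k≤y = ∈-applyDownFrom (givenk>X n a b ∘ suc) (≤-sqrt-pred (Pentagon.ky≡b+X p) X<k k≤y) (givenk>X≡ p (<⇒≤ X<k))
  ...   | inj₂ y≤k = ∈-giveny>X {n} {a} {b} {s} (go p X<y y≤k)
    where
    -- With X < Y and X < k, not being merged leaves kX < b + X = ky.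
    X<y : X < y
    X<y = *-cancelˡ-< k X y (subst (k * X <_) (sym (Pentagon.ky≡b+X p)) (≰⇒> λ h → ¬merged (X<Y , ≰⇒> k≰X , h)))
    go : ∀ {x y} → Pentagon n a b k X Y x y → X < y → y ≤ k →
      (a , b , k , X , Y) ∈ applyDownFrom (giveny>X n a b ∘ suc) (sqrt (b ∸ 1))
    go {y = 1}           p X<y _   = ⊥-elim (<⇒≱ X<y (Pentagon.0<X p))
    go {y = suc (suc j)} p X<y y≤k = ∈-applyDownFrom (giveny>X n a b ∘ suc)
      (≤-sqrt-pred (trans (*-comm (2 + j) k) (Pentagon.ky≡b+X p)) X<y y≤k) (giveny>X≡ p (<⇒≤ X<y))

  ∈-block : ∀ {a b k X Y x y} → Pentagon n a b k X Y x y → merge (a , b , k , X , Y) ∈ block n a b s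
  ∈-block {a} {b} {k} {X} {Y} p with merged? (a , b , k , X , Y)
  ... | yes (X<Y , _) = ∈-givenX≥y {n} {a} {b} {s} (go (Pentagon.0<X p) (sqrt-max (≤-trans (*-monoʳ-≤ X (<⇒≤ X<Y)) (<⇒≤ (XY<n p)))))
    where
    go : ∀ {X} → 0 < X → X ≤ s → (a , b , 0 , X , 0) ∈ applyDownFrom (givenX≥y n a b) s
    go {suc j} _ j<s = ∈-applyDownFrom⁺ (givenX≥y n a b) j<s
  ... | no ¬merged with Y ≤? X
  ...   | yes Y≤X = ∈-block-Y≤X p Y≤X
  ...   | no  Y≰X = ∈-block-X<Y p ¬merged (≰⇒> Y≰X)

  ∈-candidates : ∀ {c q} → Represents n c q → merge c ∈ candidates n
  ∈-candidates (represents {a} {b} {k} {X} {Y} p nf) =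
    ∈-concatMap (λ a → block n a (quot n a) s)
      (∈-divisorsUpTo⁺ (a>0 p) (sqrt-max (≤-trans (*-monoʳ-≤ a (normal⇒≤ nf)) (≤-reflexive ab≡n))) (divides b n≡ba))
      (subst (λ b′ → merge (a , b , k , X , Y) ∈ block n a b′ s)
        (sym (trans (cong (λ m → quot m a) n≡ba) (quot-* b (a>0 p)))) (∈-block p))
    where
    open Pentagon p
    n≡ba : n ≡ b * a
    n≡ba = trans (sym ab≡n) (*-comm a b)

-- Comparing the solutions with the candidates

-- A merged solution is recognised by k = 0 and any other is valid, so discarding the remaining
-- candidates sharpens the bound without losing a solution.
Relaxed : ℕ → Code → Set
Relaxed n c@(_ , _ , k , _ , _) = k ≡ 0 ⊎ Valid n c

relaxed? : ∀ n c → Dec (Relaxed n c)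
relaxed? n c@(_ , _ , k , _ , _) = k ≟ 0 ⊎-dec valid? n c

merge-relaxed : ∀ {n} c → Valid n c → Relaxed n (merge c)
merge-relaxed c v with merged? c
... | yes _ = inj₁ refl
... | no  _ = inj₂ v

solutionCodes-unique : ∀ n → Unique (solutionCodes n)
solutionCodes-unique n = DecUnique.deduplicate-! _≟ᶜ_ (filter (valid? n) (box n))

solutionCodes-sound : ∀ {n c} → c ∈ solutionCodes n → Valid n c
solutionCodes-sound {n} = proj₂ ∘ ∈-filter⁻ (valid? n) {xs = box n} ∘ ∈-deduplicate⁻ _≟ᶜ_ (filter (valid? n) (box n))

solutionCodes-complete : ∀ {n c} → Valid n c → c ∈ solutionCodes n
solutionCodes-complete {n} {c} v = ∈-deduplicate⁺ _≟ᶜ_ (∈-filter⁺ (valid? n) (∈-box (proj₂ (valid⇒represents c v))) v)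

solutionCodes-≤ : ∀ {n} {cs : List Code} → (∀ {c q} → Represents n c q → merge c ∈ cs) → length (solutionCodes n) ≤ length cs
solutionCodes-≤ {n} ∈cs = length-≤ merge (solutionCodes-unique n) (λ c∈ → ∈cs (proj₂ (repr c∈)))
  (λ c∈ c′∈ → merge-injective (proj₂ (repr c∈)) (proj₂ (repr c′∈)))
  where
  repr : ∀ {c} → c ∈ solutionCodes n → ∃[ q ] Represents n c q
  repr {c} c∈ = valid⇒represents c (solutionCodes-sound {n} c∈)

solutionCodes≤candidates : ∀ n → length (solutionCodes n) ≤ length (candidates n)
solutionCodes≤candidates n = solutionCodes-≤ {n} ∈-candidates

solutionCodes≤relaxed : ∀ n → length (solutionCodes n) ≤ length (filter (relaxed? n) (candidates n))
solutionCodes≤relaxed n = solutionCodes-≤ {n} λ r → ∈-filter⁺ (relaxed? n) (∈-candidates r) (merge-relaxed _ (represents⇒valid r))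

-- The number of candidates

weight : (s a b : ℕ) → ℕ
weight s a b = s + (s + ((a ∸ 1) + (t + (t + s))))
  where
  t : ℕ
  t = sqrt (b ∸ 1)

totalUpTo : ℕ → ℕ → ℕ
totalUpTo n s = sum (map (λ a → weight s a (quot n a)) (divisorsUpTo n s))

total : ℕ → ℕ
total n = totalUpTo n (sqrt n)

length-block : ∀ n a b s → length (block n a b s) ≡ weight s a b
length-block n a b s =
  length-++-applyDownFrom (givenY n a b) s $ length-++-applyDownFrom (givenX n a b) s $
  length-++-applyDownFrom (givenk>Y n a b) (a ∸ 1) $ length-++-applyDownFrom (givenk>X n a b ∘ suc) t $
  length-++-applyDownFrom (giveny>X n a b ∘ suc) t $ length-applyDownFrom (givenX≥y n a b) s
  where
  t : ℕ
  t = sqrt (b ∸ 1)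
  length-++-applyDownFrom : ∀ (f : ℕ → Code) m {cs l} → length cs ≡ l → length (applyDownFrom f m ++ cs) ≡ m + l
  length-++-applyDownFrom f m eq = trans (length-++ (applyDownFrom f m)) (cong₂ _+_ (length-applyDownFrom f m) eq)

length-candidates : ∀ n → length (candidates n) ≡ total n
length-candidates n = trans (length-concatMap (λ a → block n a (quot n a) (sqrt n)) as)
  (cong sum (map-cong (λ a → length-block n a (quot n a) (sqrt n)) as))
  where
  as : List ℕ
  as = divisorsUpTo n (sqrt n)

double-square : ∀ m → 2 * m * (2 * m) ≡ 4 * (m * m)
double-square m = [m*n]*[o*p]≡[m*o]*[n*p] 2 m 2 m

-- Three of the lists have length s; the others have total length a - 1 + 2t ≤ 2s because at² < (s +
-- 1)². This gives t ≤ s for a = 1; t < s for a = 2 and 3, since (s + 1)² ≤ 2s² once s ≥ 3; and 2t ≤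
-- s + 1 for a ≥ 4, where a ≤ s finishes.
weight-≤ : ∀ {n s a b} → IsSqrt n s → 3 ≤ s → 0 < a → a ≤ s → a * b ≡ n → weight s a b ≤ 5 * s
weight-≤ {n} {s} {a} {b} (_ , n<[1+s]²) 3≤s 0<a a≤s ab≡n = begin
  s + (s + ((a ∸ 1) + (t + (t + s))))   ≡⟨ cong (λ m → s + (s + m)) (trans (cong ((a ∸ 1) +_) (sym (+-assoc t t s)))
                                             (sym (+-assoc (a ∸ 1) (t + t) s))) ⟩
  s + (s + ((a ∸ 1 + (t + t)) + s))     ≤⟨ +-monoʳ-≤ s (+-monoʳ-≤ s (+-monoˡ-≤ s (bound a 0<a a≤s at²<[1+s]²))) ⟩
  s + (s + ((s + s) + s))               ≡⟨ cong (λ m → s + (s + m)) (trans (+-assoc s s s)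
                                             (cong (λ m → s + (s + m)) (sym (+-identityʳ s)))) ⟩
  5 * s                                 ∎
  where
  open ≤-Reasoning
  t : ℕ
  t = sqrt (b ∸ 1)
  at²<[1+s]² : a * (t * t) < suc s * suc s
  at²<[1+s]² = ≤-<-trans (≤-trans (*-monoʳ-≤ a (≤-trans (proj₁ (sqrt-isSqrt (b ∸ 1))) (m∸n≤m b 1))) (≤-reflexive ab≡n)) n<[1+s]²

  t<s : ∀ a → 2 ≤ a → a * (t * t) < suc s * suc s → t < s
  t<s a 2≤a at²< = ≰⇒> λ s≤t → <⇒≱ at²< (begin
    suc s * suc s           ≡⟨ cong suc (trans (cong (s +_) (*-suc s s)) (sym (+-assoc s s (s * s)))) ⟩
    suc (s + s) + s * s     ≤⟨ +-monoˡ-≤ (s * s) 1+2s≤s² ⟩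
    s * s + s * s           ≡⟨ cong (s * s +_) (+-identityʳ (s * s)) ⟨
    2 * (s * s)             ≤⟨ *-mono-≤ 2≤a (*-mono-≤ s≤t s≤t) ⟩
    a * (t * t)             ∎)
    where
    1+2s≤s² : suc (s + s) ≤ s * s
    1+2s≤s² = begin
      suc (s + s)       ≤⟨ +-monoˡ-≤ (s + s) (≤-trans (s≤s z≤n) 3≤s) ⟩
      s + (s + s)       ≡⟨ cong (λ m → s + (s + m)) (+-identityʳ s) ⟨
      3 * s             ≤⟨ *-monoˡ-≤ s 3≤s ⟩
      s * s             ∎

  bound : ∀ a → 0 < a → a ≤ s → a * (t * t) < suc s * suc s → a ∸ 1 + (t + t) ≤ s + s
  bound 1 _ _ at²< = +-mono-≤ t≤s t≤s
    where
    t≤s : t ≤ s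
    t≤s = ≮⇒≥ λ s<t → <⇒≱ (subst (_< suc s * suc s) (+-identityʳ (t * t)) at²<) (*-mono-≤ {x = suc s} {y = t} s<t s<t)
  bound 2 _ _ at²< = ≤-trans (n≤1+n _) (≤-trans (≤-reflexive (cong suc (sym (+-suc t t)))) (+-mono-≤ (t<s 2 ≤-refl at²<) (t<s 2 ≤-refl at²<)))
  bound 3 _ _ at²< = ≤-trans (≤-reflexive (cong suc (sym (+-suc t t)))) (+-mono-≤ (t<s 3 (n≤1+n 2) at²<) (t<s 3 (n≤1+n 2) at²<))
  bound a@(suc a-1@(suc (suc (suc a-4)))) _ a≤s at²< = begin
    a-1 + (t + t)       ≤⟨ +-monoʳ-≤ a-1 2t≤1+s ⟩
    a-1 + suc s         ≡⟨ +-suc a-1 s ⟩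
    a + s               ≤⟨ +-monoˡ-≤ s a≤s ⟩
    s + s               ∎
    where
    2t≤1+s : t + t ≤ suc s
    2t≤1+s = ≮⇒≥ λ 1+s<2t → <⇒≱ at²< (begin
      suc s * suc s           ≤⟨ *-mono-≤ (<⇒≤ 1+s<2t) (<⇒≤ 1+s<2t) ⟩
      (t + t) * (t + t)       ≡⟨ cong (λ m → (t + m) * (t + m)) (+-identityʳ t) ⟨
      2 * t * (2 * t)         ≡⟨ double-square t ⟩
      4 * (t * t)             ≤⟨ *-monoˡ-≤ (t * t) (m≤m+n 4 a-4) ⟩
      a * (t * t)             ∎)

-- Bounding the number of divisors

-- The bound d(n) ≤ d, witnessed by a list that may also contain repetitions and other numbers, so
-- that such lists can simply be concatenated.
Covered : ℕ → ℕ → Set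
Covered n d = ∃[ ds ] length ds ≤ d × (∀ {t} → t ∣ n → t ∈ ds)

module _ {n s : ℕ} ([1+s]²≤n : suc s * suc s ≤ n) where
  private
    small smaller : List ℕ
    small   = divisorsUpTo n (suc s)
    smaller = divisorsUpTo n s

    both : List (ℕ ⊎ ℕ)
    both = map inj₁ small ++ map inj₂ smaller

    divisor : ℕ ⊎ ℕ → ℕ
    divisor (inj₁ a) = a
    divisor (inj₂ a) = quot n a

    quot-*-cancel : ∀ {a} → a ∈ smaller → quot n a * a ≡ n
    quot-*-cancel {a} a∈ with ∈-divisorsUpTo⁻ {n} {s} a∈
    ... | 0<a , _ , divides q n≡qa = trans (cong (_* a) (trans (cong (λ m → quot m a) n≡qa) (quot-* q 0<a))) (sym n≡qa)

    divisorsUpTo-unique : ∀ s → Unique (divisorsUpTo n s)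
    divisorsUpTo-unique s = Unique.filter⁺ (_∣? n) (Unique.applyDownFrom⁺₁ suc s λ j<i _ eq → <-irrefl (sym (suc-injective eq)) j<i)

    both-unique : Unique both
    both-unique = Unique.++⁺ (Unique.map⁺ (λ { refl → refl }) (divisorsUpTo-unique (suc s)))
      (Unique.map⁺ (λ { refl → refl }) (divisorsUpTo-unique s)) disjoint
      where
      disjoint : ∀ {v} → v ∈ map inj₁ small × v ∈ map inj₂ smaller → ⊥
      disjoint (v∈₁ , v∈₂) with ∈-map⁻ inj₁ v∈₁ | ∈-map⁻ inj₂ v∈₂
      ... | _ , _ , refl | _ , _ , ()

    ∈-both⁻ : ∀ {v} → v ∈ both → (∃[ a ] a ∈ small × v ≡ inj₁ a) ⊎ (∃[ a ] a ∈ smaller × v ≡ inj₂ a)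
    ∈-both⁻ v∈ with ∈-++⁻ (map inj₁ small) v∈
    ... | inj₁ v∈₁ = inj₁ (∈-map⁻ inj₁ v∈₁)
    ... | inj₂ v∈₂ = inj₂ (∈-map⁻ inj₂ v∈₂)

    divisor∣n : ∀ {v} → v ∈ both → divisor v ∣ n
    divisor∣n v∈ with ∈-both⁻ v∈
    ... | inj₁ (a , a∈ , refl) = proj₂ (proj₂ (∈-divisorsUpTo⁻ {n} {suc s} a∈))
    ... | inj₂ (a , a∈ , refl) = divides a (trans (sym (quot-*-cancel a∈)) (*-comm (quot n a) a))

    ≢quot : ∀ {a a′} → a ∈ small → a′ ∈ smaller → a ≢ quot n a′
    ≢quot {a} {a′} a∈ a′∈ refl = <⇒≱ (begin-strict
      a * a′          ≤⟨ *-mono-≤ (proj₁ (proj₂ (∈-divisorsUpTo⁻ {n} {suc s} a∈))) (proj₁ (proj₂ (∈-divisorsUpTo⁻ {n} {s} a′∈))) ⟩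
      suc s * s       <⟨ *-monoʳ-< (suc s) (n<1+n s) ⟩
      suc s * suc s   ≤⟨ [1+s]²≤n ⟩
      n               ∎) (≤-reflexive (sym (quot-*-cancel a′∈)))
      where open ≤-Reasoning

    quot-injective : ∀ {a a′} → a ∈ smaller → a′ ∈ smaller → quot n a ≡ quot n a′ → a ≡ a′
    quot-injective {a} {a′} a∈ a′∈ eq = *-cancelˡ-≡ a a′ (quot n a) {{≢-nonZero λ q≡0 →
        <-irrefl (trans (sym (cong (_* a) q≡0)) (quot-*-cancel a∈)) (<-≤-trans z<s [1+s]²≤n)}}
      (trans (quot-*-cancel a∈) (trans (sym (quot-*-cancel a′∈)) (cong (_* a′) (sym eq))))

    divisor-injective : ∀ {v v′} → v ∈ both → v′ ∈ both → divisor v ≡ divisor v′ → v ≡ v′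
    divisor-injective v∈ v′∈ eq with ∈-both⁻ v∈ | ∈-both⁻ v′∈
    ... | inj₁ (_ , _  , refl) | inj₁ (_ , _   , refl) = cong inj₁ eq
    ... | inj₁ (_ , a∈ , refl) | inj₂ (_ , a′∈ , refl) = ⊥-elim (≢quot a∈ a′∈ eq)
    ... | inj₂ (_ , a∈ , refl) | inj₁ (_ , a′∈ , refl) = ⊥-elim (≢quot a′∈ a∈ (sym eq))
    ... | inj₂ (_ , a∈ , refl) | inj₂ (_ , a′∈ , refl) = cong inj₂ (quot-injective a∈ a′∈ eq)

    length-small : length small ≤ suc (length smaller)
    length-small with does (suc s ∣? n)
    ... | true  = ≤-refl
    ... | false = n≤1+n _

  -- The divisors up to s + 1 and the cofactors of the divisors up to s are distinct, since a
  -- product of one from each range is at most (s + 1)s < n. Only s + 1 may lack a partner, hence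
  -- the extra 1.
  2*smallDivisors≤ : ∀ {d} → Covered n d → 2 * length small ≤ suc d
  2*smallDivisors≤ {d} (ds , |ds|≤d , covers) = begin
    2 * length small                        ≡⟨ cong (length small +_) (+-identityʳ (length small)) ⟩
    length small + length small             ≤⟨ +-monoʳ-≤ (length small) length-small ⟩
    length small + suc (length smaller)     ≡⟨ +-suc (length small) (length smaller) ⟩
    suc (length small + length smaller)     ≡⟨ cong suc (cong₂ _+_ (length-map inj₁ small) (length-map inj₂ smaller)) ⟨
    suc (length (map inj₁ small) + length (map inj₂ smaller)) ≡⟨ cong suc (length-++ (map inj₁ small)) ⟨
    suc (length both)                       ≤⟨ s≤s (length-≤ divisor both-unique (λ v∈ → covers (divisor∣n v∈)) divisor-injective) ⟩
    suc (length ds)                         ≤⟨ s≤s |ds|≤d ⟩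
    suc d                                   ∎
    where open ≤-Reasoning

smallDivisors-bound : ∀ {n s d} → s * s ≤ n → Covered n d → 2 * length (divisorsUpTo n s) ≤ suc d
smallDivisors-bound {s = zero}  _    _ = z≤n
smallDivisors-bound {s = suc s} s²≤n c = 2*smallDivisors≤ s²≤n c

-- 2 total ≤ 5s (d + 1) and s² ≤ n.
total<n : ∀ {n d} → Covered n d → 25 * (1 + d) ^ 2 < 4 * n → total n < n
total<n {n} {d} c 25[1+d]²<4n = go (length as) refl
  where
  open ≤-Reasoning
  s : ℕ
  s = sqrt n
  as : List ℕ
  as = divisorsUpTo n s
  isSqrt : IsSqrt n s
  isSqrt = sqrt-isSqrt n
  0<n : 0 < n
  0<n = n≢0⇒n>0 λ { refl → <⇒≱ 25[1+d]²<4n z≤n }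
  2as≤ : 2 * length as ≤ suc d
  2as≤ = smallDivisors-bound {n} {s} (proj₁ isSqrt) c
  -- An empty list makes the total 0. A nonempty one gives d ≥ 1, so 100 < 4n and s ≥ 3, as
  -- `weight-≤` requires.
  go : ∀ l → length as ≡ l → total n < n
  go zero eq = ≤-<-trans (≤-trans (sum-map-≤ (λ a → weight s a (quot n a)) {0} as
    (empty {f = λ a → weight s a (quot n a)} eq)) (≤-reflexive (*-zeroʳ (length as)))) 0<n
    where
    empty : ∀ {as : List ℕ} {f : ℕ → ℕ} → length as ≡ 0 → ∀ {a} → a ∈ as → f a ≤ 0
    empty {[]} _ ()
  go (suc l) eq = *-cancelˡ-< 2 (total n) n (square-cancel-< (begin-strict
      2 * total n * (2 * total n)           ≤⟨ *-mono-≤ 2total≤ 2total≤ ⟩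
      5 * s * suc d * (5 * s * suc d)       ≡⟨ [m*n]*[o*p]≡[m*o]*[n*p] (5 * s) (suc d) (5 * s) (suc d) ⟩
      5 * s * (5 * s) * (suc d * suc d)     ≡⟨ cong (_* (suc d * suc d)) ([m*n]*[o*p]≡[m*o]*[n*p] 5 s 5 s) ⟩
      25 * (s * s) * (suc d * suc d)        ≤⟨ *-monoˡ-≤ (suc d * suc d) (*-monoʳ-≤ 25 (proj₁ isSqrt)) ⟩
      25 * n * (suc d * suc d)              ≡⟨ cong (_* (suc d * suc d)) (*-comm 25 n) ⟩
      n * 25 * (suc d * suc d)              ≡⟨ *-assoc n 25 (suc d * suc d) ⟩
      n * (25 * (suc d * suc d))            ≡⟨ cong (λ m → n * (25 * (suc d * m))) (*-identityʳ (suc d)) ⟨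
      n * (25 * suc d ^ 2)                  <⟨ *-monoʳ-< n {{>-nonZero 0<n}} 25[1+d]²<4n ⟩
      n * (4 * n)                           ≡⟨ *-assoc n 4 n ⟨
      n * 4 * n                             ≡⟨ cong (_* n) (*-comm n 4) ⟩
      4 * n * n                             ≡⟨ *-assoc 4 n n ⟩
      4 * (n * n)                           ≡⟨ double-square n ⟨
      2 * n * (2 * n)                       ∎))
    where
    square-cancel-< : ∀ {p q} → p * p < q * q → p < q
    square-cancel-< p²<q² = ≰⇒> λ q≤p → <⇒≱ p²<q² (*-mono-≤ q≤p q≤p)
    26≤n : 26 ≤ n
    26≤n = *-cancelˡ-< 4 25 n (≤-<-trans (*-monoʳ-≤ 25 (^-monoˡ-≤ 2 2≤1+d)) 25[1+d]²<4n)
      where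
      2≤1+d : 2 ≤ suc d
      2≤1+d = ≤-trans (*-monoʳ-≤ 2 (subst (1 ≤_) (sym eq) (s≤s z≤n))) 2as≤
    3≤s : 3 ≤ s
    3≤s = ≰⇒> λ s≤2 → <⇒≱ (proj₂ isSqrt) (≤-trans (*-mono-≤ (s≤s s≤2) (s≤s s≤2)) (≤-trans (m≤m+n 9 17) 26≤n))
    total≤ : total n ≤ length as * (5 * s)
    total≤ = sum-map-≤ (λ a → weight s a (quot n a)) as each
      where
      each : ∀ {a} → a ∈ as → weight s a (quot n a) ≤ 5 * s
      each {a} a∈ with ∈-divisorsUpTo⁻ {n} {s} a∈
      ... | 0<a , a≤s , divides q n≡qa = weight-≤ {n} isSqrt 3≤s 0<a a≤s
        (trans (cong (a *_) (trans (cong (λ m → quot m a) n≡qa) (quot-* q 0<a))) (trans (*-comm a q) (sym n≡qa)))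
    2total≤ : 2 * total n ≤ 5 * s * suc d
    2total≤ = begin
      2 * total n                   ≤⟨ *-monoʳ-≤ 2 total≤ ⟩
      2 * (length as * (5 * s))     ≡⟨ *-assoc 2 (length as) (5 * s) ⟨
      2 * length as * (5 * s)       ≤⟨ *-monoˡ-≤ (5 * s) 2as≤ ⟩
      suc d * (5 * s)               ≡⟨ *-comm (suc d) (5 * s) ⟩
      5 * s * suc d                 ∎

-- Divisor bounds from prime factors

^-distribʳ-* : ∀ o m n → (m * n) ^ o ≡ m ^ o * n ^ o
^-distribʳ-* zero    m n = refl
^-distribʳ-* (suc o) m n = trans (cong (m * n *_) (^-distribʳ-* o m n)) ([m*n]*[o*p]≡[m*o]*[n*p] m n (m ^ o) (n ^ o))

covered-1 : Covered 1 1
covered-1 = 1 ∷ [] , ≤-refl , λ t∣1 → here (∣1⇒≡1 t∣1)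

covered-mono : ∀ {n d e} → d ≤ e → Covered n d → Covered n e
covered-mono d≤e (ds , |ds|≤d , covers) = ds , ≤-trans |ds|≤d d≤e , covers

prime∤⇒coprime : ∀ {p t} → Prime p → ¬ p ∣ t → Coprime t p
prime∤⇒coprime pr p∤t (d∣t , d∣p) with prime⇒irreducible pr d∣p
... | inj₁ d≡1  = d≡1
... | inj₂ refl = ⊥-elim (p∤t d∣t)

∣-drop-power : ∀ {p t m} → Prime p → ¬ p ∣ t → ∀ e → t ∣ p ^ e * m → t ∣ m
∣-drop-power {m = m} pr p∤t zero    t∣ = subst (_ ∣_) (*-identityˡ m) t∣
∣-drop-power {p} {t} {m} pr p∤t (suc e) t∣ = ∣-drop-power pr p∤t e
  (coprime-divisor (prime∤⇒coprime pr p∤t) (subst (t ∣_) (*-assoc p (p ^ e) m) t∣))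

-- A divisor of p^(e + 1) m prime to p divides m; any other is p times a divisor of p^e m. The case
-- p ∣ m occurs when repeated primes from 11 on are removed one at a time.
covered-power : ∀ {p m d} → Prime p → Covered m d → ∀ e → Covered (p ^ e * m) (suc e * d)
covered-power {p} {m} {d} pr c zero = subst₂ Covered (sym (*-identityˡ m)) (sym (*-identityˡ d)) c
covered-power {p} {m} {d} pr c@(ds , |ds|≤d , covers) (suc e) with covered-power pr c e
... | es , |es|≤ , covers′ = ds ++ map (p *_) es , length≤ , covers″
  where
  length≤ : length (ds ++ map (p *_) es) ≤ d + suc e * d
  length≤ = ≤-trans (≤-reflexive (trans (length-++ ds) (cong (length ds +_) (length-map (p *_) es)))) (+-mono-≤ |ds|≤d |es|≤)
  covers″ : ∀ {t} → t ∣ p ^ suc e * m → t ∈ ds ++ map (p *_) es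
  covers″ {t} t∣ with p ∣? t
  ... | no  p∤t = ∈-++⁺ˡ (covers (∣-drop-power pr p∤t (suc e) t∣))
  ... | yes (divides q refl) = ∈-++⁺ʳ ds (subst (_∈ map (p *_) es) (*-comm p q) (∈-map⁺ (p *_) (covers′
    (*-cancelˡ-∣ p {{prime⇒nonZero pr}} (subst₂ _∣_ (*-comm q p) (*-assoc p (p ^ e) m) t∣)))))

-- Removing a prime factor p ≥ 11 divides m by at least 11 and at most halves the number of divisors.
roughBound : ℕ → ℕ → ℕ
roughBound zero    m = 1
roughBound (suc f) m with m <? 11
... | yes _ = 1
... | no  _ = 2 * roughBound f (m / 11)

AllPrimeFactors≥11 : ℕ → Set
AllPrimeFactors≥11 m = ∀ {p} → Prime p → p ∣ m → 11 ≤ p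

rough-split : ∀ {m} → 0 < m → AllPrimeFactors≥11 m →
  m ≡ 1 ⊎ ∃[ p ] ∃[ m′ ] Prime p × 11 ≤ p × m ≡ p * m′ × AllPrimeFactors≥11 m′
rough-split {m} 0<m rough = go factors isFactorisation factorsPrime
  where
  open PrimeFactorisation (factorise m {{>-nonZero 0<m}})
  go : ∀ fs → m ≡ product fs → All Prime fs →
    m ≡ 1 ⊎ ∃[ p ] ∃[ m′ ] Prime p × 11 ≤ p × m ≡ p * m′ × AllPrimeFactors≥11 m′
  go []       m≡ _        = inj₁ m≡
  go (p ∷ fs) m≡ (pr All.∷ _) = inj₂ (p , product fs , pr , rough pr (divides (product fs) (trans m≡ (*-comm p _))) , m≡ ,
    λ pr′ p′∣ → rough pr′ (∣-trans p′∣ (divides p m≡)))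

roughBound>0 : ∀ f m → 0 < roughBound f m
roughBound>0 zero    m = z<s
roughBound>0 (suc f) m with m <? 11
... | yes _ = z<s
... | no  _ = ≤-trans (roughBound>0 f (m / 11)) (m≤m+n _ _)

-- Each doubling multiplies the cube by 8, while m loses a factor of at least 11.
roughBound-cube : ∀ f m → 0 < m → roughBound f m ^ 3 ≤ m
roughBound-cube zero    m 0<m = 0<m
roughBound-cube (suc f) m 0<m with m <? 11
... | yes _    = 0<m
... | no m≮11 = begin
  (2 * r) ^ 3       ≡⟨ ^-distribʳ-* 3 2 r ⟩
  8 * r ^ 3         ≤⟨ *-mono-≤ (m≤m+n 8 3) (roughBound-cube f (m / 11) (m≥n⇒m/n>0 (≮⇒≥ m≮11))) ⟩
  11 * (m / 11)     ≡⟨ *-comm 11 (m / 11) ⟩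
  m / 11 * 11       ≤⟨ m/n*n≤m m 11 ⟩
  m                 ∎
  where
  open ≤-Reasoning
  r : ℕ
  r = roughBound f (m / 11)

-- The induction keeps an upper bound M of m, because the computation divides by 11 instead of the
-- unknown prime p; m / p ≤ M / 11 is all it needs.
roughBound-covers : ∀ f {M m} → M ≤ f → 0 < m → m ≤ M → AllPrimeFactors≥11 m → Covered m (roughBound f M)
roughBound-covers zero    M≤0 0<m m≤M _ = ⊥-elim (<⇒≱ 0<m (≤-trans m≤M M≤0))
roughBound-covers (suc f) {M} M≤1+f 0<m m≤M rough with M <? 11 | rough-split 0<m rough
... | yes _    | inj₁ refl = covered-1
... | no  _    | inj₁ refl = covered-mono (≤-trans (roughBound>0 f (M / 11)) (m≤m+n _ _)) covered-1
... | yes _    | inj₂ (p , zero , _ , _ , refl , _) = ⊥-elim (<-irrefl (sym (*-zeroʳ p)) 0<m)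
... | yes M<11 | inj₂ (p , suc m′ , _ , 11≤p , refl , _) = ⊥-elim (<⇒≱ M<11 (≤-trans (≤-trans 11≤p (m≤m*n p (suc m′))) m≤M))
... | no  M≮11 | inj₂ (p , m′ , pr , 11≤p , refl , rough′) =
  subst₂ Covered (cong (_* m′) (*-identityʳ p)) refl (covered-power pr (roughBound-covers f M/11≤f 0<m′ m′≤M/11 rough′) 1)
  where
  M/11≤f : M / 11 ≤ f
  M/11≤f = ≤-pred (≤-trans (m/n<m M 11 {{>-nonZero (<-≤-trans 0<m m≤M)}} (s≤s (s≤s z≤n))) M≤1+f)
  m′≤M/11 : m′ ≤ M / 11
  m′≤M/11 = subst (_≤ M / 11) (m*n/n≡m m′ 11)
    (/-monoˡ-≤ 11 (≤-trans (≤-trans (≤-reflexive (*-comm m′ 11)) (*-monoˡ-≤ m′ 11≤p)) m≤M))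
  0<m′ : 0 < m′
  0<m′ = n≢0⇒n>0 λ { refl → <-irrefl (sym (*-zeroʳ p)) 0<m }

-- The continuation k receives w (e + i) and m / pⁱ for the largest i; continuations
-- rather than pairs because a let-bound pair is re-evaluated for each component.
strip : (p : ℕ) .{{_ : NonZero p}} → (f e w m : ℕ) → (ℕ → ℕ → ℕ) → ℕ
strip p zero    e w m k = k (e * w) m
strip p (suc f) e w m k with m % p
... | zero  = strip p f (suc e) w (m / p) k
... | suc _ = k (e * w) m

strip-elim : ∀ (P : ℕ → Set) {p} .{{_ : NonZero p}} → 1 < p → ∀ f e w m k → 0 < m → m ≤ f →
  (∀ j m′ → 0 < m′ → ¬ p ∣ m′ → m ≡ p ^ j * m′ → P (k ((j + e) * w) m′)) → P (strip p f e w m k)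
strip-elim P     1<p zero    e w m k 0<m m≤0 h = ⊥-elim (<⇒≱ 0<m m≤0)
strip-elim P {p} 1<p (suc f) e w m k 0<m m≤1+f h with m % p in m%p≡
... | suc _ = h 0 m 0<m (λ p∣m → 0≢1+n (trans (sym (n∣m⇒m%n≡0 m p p∣m)) m%p≡)) (sym (*-identityˡ m))
... | zero  = strip-elim P 1<p f (suc e) w (m / p) k 0<m/p m/p≤f λ j m′ 0<m′ p∤m′ m/p≡ →
    subst (λ i → P (k (i * w) m′)) (sym (+-suc j e))
      (h (suc j) m′ 0<m′ p∤m′ (trans (sym (m*[n/m]≡n p∣m)) (trans (cong (p *_) m/p≡) (sym (*-assoc p (p ^ j) m′)))))
  where
  p∣m : p ∣ m
  p∣m = m%n≡0⇒n∣m m p m%p≡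
  0<m/p : 0 < m / p
  0<m/p = m≥n⇒m/n>0 (∣⇒≤ {{>-nonZero 0<m}} p∣m)
  m/p≤f : m / p ≤ f
  m/p≤f = ≤-pred (≤-trans (m/n<m m p {{>-nonZero 0<m}} 1<p) m≤1+f)

-- Exponents are counted from 1, so w collects the exact factors i + 1 for 2, 3, 5 and 7; only the
-- cofactor prime to 210 is estimated.
divisorBound : ℕ → ℕ
divisorBound n =
  strip 2 n 1 1 n λ w m → strip 3 n 1 w m λ w m → strip 5 n 1 w m λ w m → strip 7 n 1 w m λ w m → w * roughBound n m

-- Once the step from J to J + 1 holds it holds forever, since (i + 2) / (i + 1) decreases.
cube≤power : ∀ u v p J → u * suc J ^ 3 ≤ v * p ^ J → suc (suc J) ^ 3 ≤ p * suc J ^ 3 →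
  ∀ i → u * suc (i + J) ^ 3 ≤ v * p ^ (i + J)
cube≤power u v p J base step zero    = base
cube≤power u v p J base step (suc i) = begin
  u * suc (suc K) ^ 3         ≤⟨ *-monoʳ-≤ u grow ⟩
  u * (p * suc K ^ 3)         ≡⟨ swap₃ u p (suc K ^ 3) ⟩
  p * (u * suc K ^ 3)         ≤⟨ *-monoʳ-≤ p (cube≤power u v p J base step i) ⟩
  p * (v * p ^ K)             ≡⟨ swap₃ p v (p ^ K) ⟩
  v * (p * p ^ K)             ∎
  where
  open ≤-Reasoning
  K : ℕ
  K = i + J
  swap₃ : ∀ x y z → x * (y * z) ≡ y * (x * z)
  swap₃ x y z = trans (sym (*-assoc x y z)) (trans (cong (_* z) (*-comm x y)) (*-assoc y x z))
  cross : suc (suc K) * suc J ≤ suc (suc J) * suc K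
  cross = begin
    suc J + suc K * suc J   ≤⟨ +-monoˡ-≤ (suc K * suc J) (s≤s (m≤n+m J i)) ⟩
    suc K + suc K * suc J   ≡⟨ cong (suc K +_) (*-comm (suc K) (suc J)) ⟩
    suc K + suc J * suc K   ∎
  grow : suc (suc K) ^ 3 ≤ p * suc K ^ 3
  grow = *-cancelʳ-≤ _ _ (suc J ^ 3) {{m^n≢0 (suc J) 3}} (begin
    suc (suc K) ^ 3 * suc J ^ 3     ≡⟨ ^-distribʳ-* 3 (suc (suc K)) (suc J) ⟨
    (suc (suc K) * suc J) ^ 3       ≤⟨ ^-monoˡ-≤ 3 cross ⟩
    (suc (suc J) * suc K) ^ 3       ≡⟨ ^-distribʳ-* 3 (suc (suc J)) (suc K) ⟩
    suc (suc J) ^ 3 * suc K ^ 3     ≤⟨ *-monoˡ-≤ (suc K ^ 3) step ⟩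
    p * suc J ^ 3 * suc K ^ 3       ≡⟨ *-assoc p (suc J ^ 3) (suc K ^ 3) ⟩
    p * (suc J ^ 3 * suc K ^ 3)     ≡⟨ cong (p *_) (*-comm (suc J ^ 3) (suc K ^ 3)) ⟩
    p * (suc K ^ 3 * suc J ^ 3)     ≡⟨ *-assoc p (suc K ^ 3) (suc J ^ 3) ⟨
    p * suc K ^ 3 * suc J ^ 3       ∎)

-- The constants 8, 3, 8/5 and 8/7 here and below are the maxima of (i + 1)³ / pⁱ, attained at i =
-- 3, 2, 1, 1. Their product is 1536/35.
cube≤2^ : ∀ i → 1 * suc i ^ 3 ≤ 8 * 2 ^ i
cube≤2^ 0 = from-yes (1 ≤? 8)
cube≤2^ 1 = from-yes (8 ≤? 16)
cube≤2^ 2 = from-yes (27 ≤? 32)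
cube≤2^ (suc (suc (suc i))) = subst₂ _≤_ (cong (λ m → 1 * suc m ^ 3) (+-comm i 3)) (cong (λ m → 8 * 2 ^ m) (+-comm i 3))
  (cube≤power 1 8 2 3 (from-yes (64 ≤? 64)) (from-yes (125 ≤? 128)) i)

cube≤3^ : ∀ i → 1 * suc i ^ 3 ≤ 3 * 3 ^ i
cube≤3^ 0 = from-yes (1 ≤? 3)
cube≤3^ 1 = from-yes (8 ≤? 9)
cube≤3^ (suc (suc i)) = subst₂ _≤_ (cong (λ m → 1 * suc m ^ 3) (+-comm i 2)) (cong (λ m → 3 * 3 ^ m) (+-comm i 2))
  (cube≤power 1 3 3 2 (from-yes (27 ≤? 27)) (from-yes (64 ≤? 81)) i)

cube≤5^ : ∀ i → 5 * suc i ^ 3 ≤ 8 * 5 ^ i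
cube≤5^ 0 = from-yes (5 ≤? 8)
cube≤5^ (suc i) = subst₂ _≤_ (cong (λ m → 5 * suc m ^ 3) (+-comm i 1)) (cong (λ m → 8 * 5 ^ m) (+-comm i 1))
  (cube≤power 5 8 5 1 (from-yes (40 ≤? 40)) (from-yes (27 ≤? 40)) i)

cube≤7^ : ∀ i → 7 * suc i ^ 3 ≤ 8 * 7 ^ i
cube≤7^ 0 = from-yes (7 ≤? 8)
cube≤7^ (suc i) = subst₂ _≤_ (cong (λ m → 7 * suc m ^ 3) (+-comm i 1)) (cong (λ m → 8 * 7 ^ m) (+-comm i 1))
  (cube≤power 7 8 7 1 (from-yes (56 ≤? 56)) (from-yes (27 ≤? 56)) i)

primeFactors≥11 : ∀ {m} → ¬ 2 ∣ m → ¬ 3 ∣ m → ¬ 5 ∣ m → ¬ 7 ∣ m → AllPrimeFactors≥11 m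
primeFactors≥11 {m} 2∤m 3∤m 5∤m 7∤m pr p∣m = ≮⇒≥ (go _ pr p∣m)
  where
  go : ∀ p → Prime p → p ∣ m → ¬ p < 11
  go 0  pr _  _ = ⊥-elim (¬prime[0] pr)
  go 1  pr _  _ = ⊥-elim (¬prime[1] pr)
  go 2  _ p∣m _ = 2∤m p∣m
  go 3  _ p∣m _ = 3∤m p∣m
  go 4  _ p∣m _ = 2∤m (∣-trans (divides 2 refl) p∣m)
  go 5  _ p∣m _ = 5∤m p∣m
  go 6  _ p∣m _ = 2∤m (∣-trans (divides 3 refl) p∣m)
  go 7  _ p∣m _ = 7∤m p∣m
  go 8  _ p∣m _ = 2∤m (∣-trans (divides 4 refl) p∣m)
  go 9  _ p∣m _ = 3∤m (∣-trans (divides 3 refl) p∣m)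
  go 10 _ p∣m _ = 2∤m (∣-trans (divides 5 refl) p∣m)
  go (suc (suc (suc (suc (suc (suc (suc (suc (suc (suc (suc p))))))))))) _ _ p<11 = <⇒≱ p<11 (m≤m+n 11 p)

∤-factor : ∀ {d m n} q → n ≡ q * m → ¬ d ∣ n → ¬ d ∣ m
∤-factor q refl d∤n d∣m = d∤n (∣n⇒∣m*n q d∣m)

cofactor≤ : ∀ {p m m′} .{{_ : NonZero p}} j → m ≡ p ^ j * m′ → m′ ≤ m
cofactor≤ {p} {m′ = m′} j refl = m≤n*m m′ (p ^ j) {{m^n≢0 p j}}

record IsDivisorBound (α β n d : ℕ) : Set where
  constructor _,_
  field
    covered : Covered n d
    αd³≤βn  : α * d ^ 3 ≤ β * n

isDivisorBound-power : ∀ {α β m d} u v {p} → Prime p → (∀ i → u * suc i ^ 3 ≤ v * p ^ i) → ∀ i →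
  IsDivisorBound α β m d → IsDivisorBound (u * α) (v * β) (p ^ i * m) ((i + 1) * d)
isDivisorBound-power {α} {β} {m} {d} u v {p} pr cube≤ i (c , αd³≤βm) =
  subst (λ e → IsDivisorBound (u * α) (v * β) (p ^ i * m) (e * d)) (+-comm 1 i) (covered-power pr c i , (begin
    u * α * (suc i * d) ^ 3         ≡⟨ cong (u * α *_) (^-distribʳ-* 3 (suc i) d) ⟩
    u * α * (suc i ^ 3 * d ^ 3)     ≡⟨ [m*n]*[o*p]≡[m*o]*[n*p] u α (suc i ^ 3) (d ^ 3) ⟩
    u * suc i ^ 3 * (α * d ^ 3)     ≤⟨ *-mono-≤ (cube≤ i) αd³≤βm ⟩
    v * p ^ i * (β * m)             ≡⟨ [m*n]*[o*p]≡[m*o]*[n*p] v (p ^ i) β m ⟩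
    v * β * (p ^ i * m)             ∎))
  where open ≤-Reasoning

reverse₄ : ∀ a b c d r → a * (b * (c * (d * r))) ≡ d * (c * (b * (a * 1))) * r
reverse₄ a b c d r = solve (a ∷ b ∷ c ∷ d ∷ r ∷ [])

divisorBound-correct : ∀ n → 0 < n → IsDivisorBound 35 1536 n (divisorBound n)
divisorBound-correct n 0<n =
  strip-elim P 1<2 n 1 1 n _ 0<n ≤-refl λ i₂ m₂ 0<m₂ 2∤m₂ n≡ →
  strip-elim P 1<3 n 1 _ m₂ _ 0<m₂ (cofactor≤ i₂ n≡) λ i₃ m₃ 0<m₃ 3∤m₃ m₂≡ →
  strip-elim P 1<5 n 1 _ m₃ _ 0<m₃ (≤-trans (cofactor≤ i₃ m₂≡) (cofactor≤ i₂ n≡)) λ i₅ m₅ 0<m₅ 5∤m₅ m₃≡ →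
  strip-elim P 1<7 n 1 _ m₅ _ 0<m₅ (≤-trans (cofactor≤ i₅ m₃≡) (≤-trans (cofactor≤ i₃ m₂≡) (cofactor≤ i₂ n≡)))
    λ i₇ m 0<m 7∤m m₅≡ →
  let m≤n = ≤-trans (cofactor≤ i₇ m₅≡) (≤-trans (cofactor≤ i₅ m₃≡) (≤-trans (cofactor≤ i₃ m₂≡) (cofactor≤ i₂ n≡)))
      5∤m = ∤-factor (7 ^ i₇) m₅≡ 5∤m₅
      3∤m = ∤-factor (7 ^ i₇) m₅≡ (∤-factor (5 ^ i₅) m₃≡ 3∤m₃)
      2∤m = ∤-factor (7 ^ i₇) m₅≡ (∤-factor (5 ^ i₅) m₃≡ (∤-factor (3 ^ i₃) m₂≡ 2∤m₂))
  in combine i₂ i₃ i₅ i₇ n≡ m₂≡ m₃≡ m₅≡ (roughBound n m)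
       (roughBound-covers n m≤n 0<m ≤-refl (primeFactors≥11 2∤m 3∤m 5∤m 7∤m)) (roughBound-cube n m 0<m)
  where
  P : ℕ → Set
  P = IsDivisorBound 35 1536 n
  1<2 : 1 < 2
  1<2 = from-yes (1 <? 2)
  1<3 : 1 < 3
  1<3 = from-yes (1 <? 3)
  1<5 : 1 < 5
  1<5 = from-yes (1 <? 5)
  1<7 : 1 < 7
  1<7 = from-yes (1 <? 7)
  combine : ∀ i₂ i₃ i₅ i₇ {m₂ m₃ m₅ m} → n ≡ 2 ^ i₂ * m₂ → m₂ ≡ 3 ^ i₃ * m₃ → m₃ ≡ 5 ^ i₅ * m₅ → m₅ ≡ 7 ^ i₇ * m →
    ∀ r → Covered m r → r ^ 3 ≤ m → P ((i₇ + 1) * ((i₅ + 1) * ((i₃ + 1) * ((i₂ + 1) * 1))) * r)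
  combine i₂ i₃ i₅ i₇ {m = m} n≡ refl refl refl r c r³≤m = subst₂ (IsDivisorBound 35 1536) (sym n≡)
    (reverse₄ (i₂ + 1) (i₃ + 1) (i₅ + 1) (i₇ + 1) r)
    (isDivisorBound-power {35} {192} 1 8 (from-yes (prime? 2)) cube≤2^ i₂
    (isDivisorBound-power {35} {64} 1 3 (from-yes (prime? 3)) cube≤3^ i₃
    (isDivisorBound-power {7} {8} 5 8 (from-yes (prime? 5)) cube≤5^ i₅
    (isDivisorBound-power {1} {1} 7 8 (from-yes (prime? 7)) cube≤7^ i₇
      (c , *-monoʳ-≤ 1 r³≤m)))))

-- The inequality for large n

-- With q = p + 1: a cubic that beats the quadratic at p beats it for all d ≥ p, because (1 + d) / d
-- ≤ q / p there.
cube-square-contradiction : ∀ {α β p q d} → α * d ^ 3 ≤ β * (1 + d) ^ 2 → 0 < d → p ≤ d → (1 + d) * p ≤ q * d →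
  ¬ β * q ^ 2 < α * p ^ 3
cube-square-contradiction {α} {β} {p} {q} {d} αd³≤βu² 0<d p≤d up≤qd βq²<αp³ = <⇒≱ βq²<αp³
  (*-cancelʳ-≤ (α * p ^ 3) (β * q ^ 2) (d ^ 2) {{m^n≢0 d 2 {{>-nonZero 0<d}}}} (begin
    α * p ^ 3 * d ^ 2         ≡⟨ e₁ α p d ⟩
    p * (α * p ^ 2 * d ^ 2)   ≤⟨ *-monoˡ-≤ (α * p ^ 2 * d ^ 2) p≤d ⟩
    d * (α * p ^ 2 * d ^ 2)   ≡⟨ e₂ α p d ⟩
    p ^ 2 * (α * d ^ 3)       ≤⟨ *-monoʳ-≤ (p ^ 2) αd³≤βu² ⟩
    p ^ 2 * (β * u ^ 2)       ≡⟨ e₃ β p u ⟩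
    β * (u * p) ^ 2           ≤⟨ *-monoʳ-≤ β (^-monoˡ-≤ 2 up≤qd) ⟩
    β * (q * d) ^ 2           ≡⟨ e₄ β q d ⟩
    β * q ^ 2 * d ^ 2         ∎))
  where
  open ≤-Reasoning
  u : ℕ
  u = 1 + d
  -- The powers are written out because the ring solver does not treat _^_.
  e₁ : ∀ α p d → α * (p * (p * (p * 1))) * (d * (d * 1)) ≡ p * (α * (p * (p * 1)) * (d * (d * 1)))
  e₁ α p d = solve (α ∷ p ∷ d ∷ [])
  e₂ : ∀ α p d → d * (α * (p * (p * 1)) * (d * (d * 1))) ≡ (p * (p * 1)) * (α * (d * (d * (d * 1))))
  e₂ α p d = solve (α ∷ p ∷ d ∷ [])
  e₃ : ∀ β p u → (p * (p * 1)) * (β * (u * (u * 1))) ≡ β * ((u * p) * ((u * p) * 1))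
  e₃ β p u = solve (β ∷ p ∷ u ∷ [])
  e₄ : ∀ β q d → β * ((q * d) * ((q * d) * 1)) ≡ β * (q * (q * 1)) * (d * (d * 1))
  e₄ β q d = solve (β ∷ q ∷ d ∷ [])

-- Otherwise 35d³ ≤ 384 (4n) ≤ 9600 (1 + d)², which fails from d = 277 on, while
-- d ≤ 276 is impossible because 25 · 277² < 4 · 480000.
divisorBound-small : ∀ {n d} → 480000 ≤ n → 35 * d ^ 3 ≤ 1536 * n → 25 * (1 + d) ^ 2 < 4 * n
divisorBound-small {n} {d} N≤n 35d³≤1536n with 277 ≤? d
... | no 277≰d = begin-strict
  25 * (1 + d) ^ 2      ≤⟨ *-monoʳ-≤ 25 (^-monoˡ-≤ 2 (≰⇒> 277≰d)) ⟩
  25 * 277 ^ 2          <⟨ from-yes (25 * 277 ^ 2 <? 4 * 480000) ⟩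
  4 * 480000            ≤⟨ *-monoʳ-≤ 4 N≤n ⟩
  4 * n                 ∎
  where open ≤-Reasoning
... | yes 277≤d = ≰⇒> λ 4n≤25u² → cube-square-contradiction {35} {9600} {277} {278} {d}
  (≤-trans 35d³≤1536n (≤-trans (≤-reflexive 1536n≡) (≤-trans (*-monoʳ-≤ 384 4n≤25u²) (≤-reflexive 9600u²≡))))
  (<-≤-trans z<s 277≤d) 277≤d (+-mono-≤ 277≤d (≤-reflexive (*-comm d 277)))
  (from-yes (9600 * 278 ^ 2 <? 35 * 277 ^ 3))
  where
  1536n≡ : 1536 * n ≡ 384 * (4 * n)
  1536n≡ = *-assoc 384 4 n
  9600u²≡ : 384 * (25 * (1 + d) ^ 2) ≡ 9600 * (1 + d) ^ 2
  9600u²≡ = sym (*-assoc 384 25 ((1 + d) ^ 2))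

-- The finite computation and the conclusion

-- The alternatives are tried in this order, so the expensive ones are evaluated only
-- where the cheap ones fail.
Certified : ℕ → Set
Certified n = 25 * (1 + divisorBound n) ^ 2 < 4 * n ⊎ total n < n ⊎
  length (filter (relaxed? n) (candidates n)) < n ⊎ length (solutionCodes n) < n

certified? : ∀ n → Dec (Certified n)
certified? n = 25 * (1 + divisorBound n) ^ 2 <? 4 * n ⊎-dec total n <? n ⊎-dec
  length (filter (relaxed? n) (candidates n)) <? n ⊎-dec length (solutionCodes n) <? n

certified⇒< : ∀ n → 0 < n → Certified n → length (solutionCodes n) < n
certified⇒< n 0<n (inj₁ small) = ≤-<-trans (≤-trans (solutionCodes≤candidates n) (≤-reflexive (length-candidates n)))
  (total<n (IsDivisorBound.covered (divisorBound-correct n 0<n)) small)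
certified⇒< n 0<n (inj₂ (inj₁ total<n)) = ≤-<-trans (≤-trans (solutionCodes≤candidates n) (≤-reflexive (length-candidates n))) total<n
certified⇒< n 0<n (inj₂ (inj₂ (inj₁ relaxed<n))) = ≤-<-trans (solutionCodes≤relaxed n) relaxed<n
certified⇒< n 0<n (inj₂ (inj₂ (inj₂ codes<n))) = codes<n

module _ {P : ℕ → Set} (P? : ∀ n → Dec (P n)) where

  -- Only the Boolean parts of the decisions are consulted; the proofs they carry are not evaluated.
  allUpTo : ℕ → Bool
  allUpTo zero    = true
  allUpTo (suc m) = does (P? (suc m)) ∧ allUpTo m

  allUpTo-sound : ∀ m → allUpTo m ≡ true → ∀ {n} → 0 < n → n ≤ m → P n
  allUpTo-sound zero    _   0<n n≤0   = contradiction n≤0 (<⇒≱ 0<n)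
  allUpTo-sound (suc m) all 0<n n≤1+m with P? (suc m) | m≤n⇒m<n∨m≡n n≤1+m
  ... | yes p | inj₂ refl  = p
  ... | yes _ | inj₁ n<1+m = allUpTo-sound m all 0<n (≤-pred n<1+m)

abstract
  certified-upTo : ∀ {n} → 0 < n → n ≤ 480000 → Certified n
  -- The check of all n up to 480000 takes place in this `refl`.
  certified-upTo = allUpTo-sound certified? 480000 refl

certified : ∀ n → 0 < n → Certified n
certified n 0<n = [ certified-upTo 0<n , inj₁ ∘ small ]′ (≤-total n 480000)
  where
  small : 480000 ≤ n → 25 * (1 + divisorBound n) ^ 2 < 4 * n
  small N≤n = divisorBound-small {n} {divisorBound n} N≤n
    (IsDivisorBound.αd³≤βn (divisorBound-correct n 0<n))

mainTheorem1 : (n : ℕ) → n > 1 → ∃[ k ] (f[ n ]≡ k) × (k < n)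
mainTheorem1 n 1<n = length (solutionCodes n) ,
  solutions↔ (solutionCodes-unique n) (solutionCodes-sound {n}) solutionCodes-complete ,
  certified⇒< n 0<n (certified n 0<n)
  where
  0<n : 0 < n
  0<n = <-trans z<s 1<n
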